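{- Let $D$ be an arc-locally out-semicomplete digraph. If $D$ does not contain a blocking odd cycle as an induced subdigraph, then $D$ is BE-diperfect.
   Context: All digraphs are finite, without loops and without multiple edges (a pair of opposite edges $uv$, $vu$ is allowed). Two vertices $u,v$ are adjacent if $uv$ or $vu$ is an edge. The underlying graph $U(D)$ is the simple graph on $V(D)$ in which two vertices are joined exactly when they are adjacent in $D$. A source is a vertex with no in-neighbor, a sink is a vertex with no out-neighbor. A digraph $D$ is arc-locally out-semicomplete if for each edge $uv\in E(D)$, every out-neighbor of $u$ and every out-neighbor of $v$ are adjacent or are the same vertex. A digraph $C$ is a blocking odd cycle if $U(C)=x_1x_2\dots x_{2k+1}x_1$ is a cycle for some $k\ge 1$, $x_1$ is a source of $C$ and $x_2$ is a sink of $C$. A stable set is a set of pairwise non-adjacent vertices. A path is a directed path with distinct vertices (a single vertex is a path). A path partition of $D$ is a collection $\mathcal{P}$ of paths of $D$ such that every vertex of $D$ belongs to exactly one path of $\mathcal{P}$. For a stable set $S$ of $D$, an $S_{BE}$-path partition of $D$ is a path partition $\mathcal{P}$ such that $|V(P)\cap S|=1$ for every $P\in\mathcal{P}$ and every vertex of $S$ starts or ends a path of $\mathcal{P}$. A digraph satisfies the BE-property if for every maximum (i.e. maximum cardinality) stable set $S$ it has an $S_{BE}$-path partition. A digraph is BE-diperfect if every one of its induced subdigraphs satisfies the BE-property. -}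

module Defs where

open import Data.Bool.Base using (Bool; T)
open import Data.Fin.Base using (Fin; zero; suc; toℕ)
open import Data.Fin.Subset using (Subset; ∣_∣) renaming (_∈_ to _∈ₛ_)
open import Data.List.Membership.Propositional using (_∈_)
open import Data.List.NonEmpty.Base using (List⁺; head; last; toList)
open import Data.List.Relation.Unary.Linked using (Linked)
open import Data.List.Relation.Unary.Unique.Propositional using (Unique)
open import Data.Nat.Base using (ℕ; suc; _*_; _≤_; NonZero)
open import Data.Nat.DivMod using (_%_)
open import Data.Product using (∃-syntax; ∃!; _×_)
open import Data.Sum.Base using (_⊎_)
open import Function.Bundles using (_⤖_; _⇔_; Bijection)
open import Function.Definitions using (Injective)
open import Relation.Binary.PropositionalEquality.Core using (_≡_)
open import Relation.Nullary.Negation.Core using (¬_)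

record Digraph (n : ℕ) : Set where
  field
    edge     : Fin n → Fin n → Bool
    loopless : ∀ v → ¬ T (edge v v)

  Edge : Fin n → Fin n → Set
  Edge u v = T (edge u v)

  -- Also the edge relation of the underlying graph U(D).
  Adjacent : Fin n → Fin n → Set
  Adjacent u v = Edge u v ⊎ Edge v u

  IsSource : Fin n → Set
  IsSource v = ∀ u → ¬ Edge u v

  IsSink : Fin n → Set
  IsSink v = ∀ u → ¬ Edge v u

open Digraph public

private
  variable
    m n : ℕ

-- H is an induced subdigraph of D, up to renaming of vertices: f identifies
-- the vertices of H with a subset of those of D.
record _IsInducedSubdigraphOf_ (H : Digraph m) (D : Digraph n) : Set where
  field
    f         : Fin m → Fin n
    injective : Injective _≡_ _≡_ f
    induced   : ∀ u v → edge H u v ≡ edge D (f u) (f v)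

ArcLocallyOutSemicomplete : Digraph n → Set
ArcLocallyOutSemicomplete D =
  ∀ {u v} → Edge D u v →
  ∀ {x y} → Edge D u x → Edge D v y → Adjacent D x y ⊎ x ≡ y

-- b is the cyclic successor of a.
Next : .{{NonZero n}} → Fin n → Fin n → Set
Next {n} a b = toℕ b ≡ suc (toℕ a) % n

-- The cycle has 2k+1 vertices with k = suc j, which encodes k ≥ 1.  Indices
-- are shifted to start at 0: x zero is x₁ and x (suc zero) is x₂.
record BlockingOddCycle (C : Digraph m) : Set where
  field
    j : ℕ

  k : ℕ
  k = suc j

  field
    vertices : Fin (suc (2 * k)) ⤖ Fin m

  x : Fin (suc (2 * k)) → Fin m
  x = Bijection.to vertices

  field
    cycle  : ∀ a b → Adjacent C (x a) (x b) ⇔ (Next a b ⊎ Next b a)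
    source : IsSource C (x zero)
    sink   : IsSink C (x (suc zero))

Stable : Digraph n → Subset n → Set
Stable D S = ∀ {u v} → u ∈ₛ S → v ∈ₛ S → ¬ Adjacent D u v

MaximumStable : Digraph n → Subset n → Set
MaximumStable D S = Stable D S × (∀ S′ → Stable D S′ → ∣ S′ ∣ ≤ ∣ S ∣)

record Path (D : Digraph n) : Set where
  field
    sequence : List⁺ (Fin n)
    linked   : Linked (Edge D) (toList sequence)
    distinct : Unique (toList sequence)

  start end : Fin n
  start = head sequence
  end   = last sequence

_∈ₚ_ : {D : Digraph n} → Fin n → Path D → Set
v ∈ₚ P = v ∈ toList (Path.sequence P)

-- Since paths are nonempty, the uniqueness of the index in covers also rules
-- out repetitions in the family.
record PathPartition (D : Digraph n) : Set where
  field
    size   : ℕ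
    path   : Fin size → Path D
    covers : ∀ v → ∃! _≡_ (λ i → v ∈ₚ path i)

-- The condition |V(P) ∩ S| = 1 is expressed by unique existence.
record BEPathPartition (D : Digraph n) (S : Subset n) : Set where
  field
    partition : PathPartition D

  open PathPartition partition public

  field
    meetsOnce : ∀ i → ∃! _≡_ (λ v → v ∈ₚ path i × v ∈ₛ S)
    extremal  : ∀ {v} → v ∈ₛ S →
                ∃[ i ] (Path.start (path i) ≡ v ⊎ Path.end (path i) ≡ v)

BEProperty : Digraph n → Set
BEProperty D = ∀ S → MaximumStable D S → BEPathPartition D S

BEDiperfect : Digraph n → Set
BEDiperfect D = ∀ {m} (H : Digraph m) → H IsInducedSubdigraphOf D → BEProperty H

ContainsInducedBlockingOddCycle : Digraph n → Set
ContainsInducedBlockingOddCycle D =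
  ∃[ m ] ∃[ C ] (C IsInducedSubdigraphOf D × BlockingOddCycle {m} C)

{-# OPTIONS --safe #-}

-- Call an induced directed odd cycle of length at least 5 a hole.  Without holes,
-- χ = ω: in a minimal counterexample, local out-semicompleteness at an initial
-- strong component produces a simplicial vertex or a vertex dominated by a
-- non-neighbour, which may then share its colour; a strong digraph is bipartite,
-- has a hole, or has a directed triangle and with it a universal or a dominated
-- vertex.  By the weak perfect graph theorem such a digraph is covered by α
-- cliques, each meeting S once, and a clique without transitive triangles has
-- a Hamiltonian path with any prescribed vertex at one end.
--
-- A hole, on the other hand, makes its weak component V triangle-free, and the
-- successors of its vertices form classes arranged in an odd cycle.  S misses two
-- consecutive classes X and Z.  Neither V − X nor V − Z has a hole, so both are
-- matched into S; the two matchings combine into a cover of V by single vertices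
-- of S, edges sv and paths s → x → z with x in X and z in Z.
module Submission where

open import Defs
open import Algebra.Properties.CommutativeMonoid.Sum using (sum; sum-cong-≗; sum-replicate-zero; ∑-distrib-+)
open import Data.Bool.Base using (T; true; false; if_then_else_)
open import Data.Bool.Properties using (T?)
open import Data.Empty using (⊥-elim)
open import Data.Fin.Base using (Fin; zero; suc)
open import Data.Fin.Properties using (_≟_; any?; all?)
open import Data.Fin.Subset
  using (Subset; inside; outside; _∈_; _∉_; _⊆_; _∩_; _∪_; _─_; _-_; ∁; ⁅_⁆; ∣_∣; ⊥; ⊤; Nonempty)
open import Data.Fin.Subset.Properties
open import Data.List.Base using (List; []; _∷_; _++_; length; map; upTo; filter; allFin; initLast; _∷ʳ′_)
  renaming (lookup to lookupₗ)
open import Data.List.Membership.Propositional using () renaming (_∈_ to _∈ₗ_)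
open import Data.List.Membership.Propositional.Properties
  using (∈-map⁺; ∈-upTo⁺; ∈-++⁺ˡ; ∈-++⁺ʳ; ∈-filter⁺; ∈-filter⁻; ∈-allFin; ∈-lookup)
open import Data.List.NonEmpty.Base using (_∷_; toList; last; _∷ʳ_)
open import Data.List.Properties using (length-map; length-upTo)
open import Data.List.Relation.Binary.Permutation.Propositional
  using (_↭_; ↭-refl; ↭-sym; ↭-trans; ↭-prep; ↭-swap; ↭⇒↭ₛ)
open import Data.List.Relation.Binary.Permutation.Propositional.Properties using (∈-resp-↭; All-resp-↭; ++-comm)
open import Data.List.Relation.Binary.Permutation.Setoid.Properties using (AllPairs-resp-↭)
open import Data.List.Relation.Unary.All as All using (All; []; _∷_)
import Data.List.Relation.Unary.All.Properties as All
open import Data.List.Relation.Unary.AllPairs as AllPairs using (AllPairs; []; _∷_)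
import Data.List.Relation.Unary.AllPairs.Properties as AllPairs
open import Data.List.Relation.Unary.Any as Any using (here; there)
open import Data.List.Relation.Unary.Any.Properties using (lookup-index)
open import Data.List.Relation.Unary.Linked using (Linked; [-]; _∷_)
open import Data.List.Relation.Unary.Linked.Properties using (AllPairs⇒Linked)
open import Data.List.Relation.Unary.Unique.Propositional.Properties using (allFin⁺; filter⁺)
open import Data.Nat.Base
  using (ℕ; zero; suc; pred; _+_; _*_; _∸_; _⊔_; _≤_; _<_; z≤n; s≤s; s≤s⁻¹; >-nonZero)
open import Data.Nat.DivMod using (_/_; _%_; m≡m%n+[m/n]*n; m%n<n)
open import Data.Nat.Induction using (<-wellFounded)
open import Data.Nat.Properties as ℕ using (_≤?_; anyUpTo?)
open import Data.Nat.Tactic.RingSolver using (solve-∀)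
open import Data.Product using (∃-syntax; ∃!; _×_; _,_; proj₁; proj₂)
open import Data.Sum.Base using (_⊎_; inj₁; inj₂; [_,_]′; swap)
open import Data.Vec.Base using ([]; _∷_; lookup; tabulate; here; there)
open import Data.Vec.Functional using (updateAt)
open import Data.Vec.Functional.Properties using (updateAt-updates; updateAt-minimal)
open import Data.Vec.Properties using (lookup⇒[]=; []=⇒lookup; lookup∘tabulate)
open import Function.Base using (_∘_; id)
open import Function.Bundles using (_⇔_; mk⇔)
open import Function.Construct.Identity using (⤖-id)
open import Induction.WellFounded using (Acc; acc)
open import Relation.Binary.Construct.Closure.ReflexiveTransitive using (Star; ε; _◅_; _◅◅_)
open import Relation.Binary.PropositionalEquality
open import Relation.Nullary using (Dec; yes; no; does; ¬_; contradiction)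
open import Relation.Nullary.Decidable
  using (map′; _×-dec_; _⊎-dec_; _→-dec_; ¬?; dec-true; decidable-stable)
open import Relation.Unary using (Decidable)

-- The hypothesis on blocking odd cycles enters through triangles: a → b → c together with a → c
-- always comes with a reversed arc. Like local out-semicompleteness, this passes to induced
-- subdigraphs, so one digraph is fixed and every induction runs over subsets `W` of its vertices. A
-- cover by α cliques is a colouring of the complement, about which the local condition says nothing
-- directly. Therefore χ = ω is proved for the graph itself and carried over to the complement by
-- Lovász's replication and a counting argument. Around a hole cliques cannot suffice: a cycle of
-- length 2K + 1 has α = K, and K cliques of at most two vertices leave one vertex over. Some path
-- must take three vertices and still have its vertex of S at an end. This is why two consecutive
-- missed classes are wanted: all arcs from X to Z are present, so a vertex of Z can be appended
-- behind any vertex of X. That two such classes exist is a parity argument on the odd cycle of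
-- classes.

private
  variable
    n : ℕ

-- Finite sums and finite subsets

Σ[_] : (Fin n → ℕ) → ℕ
Σ[ f ] = sum ℕ.+-0-commutativeMonoid f

Σ-mono : {f g : Fin n → ℕ} → (∀ v → f v ≤ g v) → Σ[ f ] ≤ Σ[ g ]
Σ-mono {zero}  f≤g = z≤n
Σ-mono {suc n} f≤g = ℕ.+-mono-≤ (f≤g zero) (Σ-mono (f≤g ∘ suc))

Σ-mono-< : {f g : Fin n → ℕ} → (∀ v → f v ≤ g v) → ∀ u → f u < g u → Σ[ f ] < Σ[ g ]
Σ-mono-< f≤g zero    fu<gu = ℕ.+-mono-<-≤ fu<gu (Σ-mono (f≤g ∘ suc))
Σ-mono-< f≤g (suc u) fu<gu = ℕ.+-mono-≤-< (f≤g zero) (Σ-mono-< (f≤g ∘ suc) u fu<gu)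

sift : {P : Fin n → Set} → Decidable P → Subset n
sift P? = tabulate (does ∘ P?)

module _ {P : Fin n → Set} (P? : Decidable P) where

  ∈-sift⁺ : ∀ {v} → P v → v ∈ sift P?
  ∈-sift⁺ {v} p = lookup⇒[]= v (sift P?) (trans (lookup∘tabulate _ v) (dec-true (P? v) p))

  ∈-sift⁻ : ∀ {v} → v ∈ sift P? → P v
  ∈-sift⁻ {v} v∈ with P? v in eq
  ... | yes p = p
  ... | no ¬p = contradiction (trans (sym ([]=⇒lookup v∈)) (trans (lookup∘tabulate _ v) (cong does eq))) λ ()

-- The indicator function of a set; in `χ≡ω` the letter stands for the chromatic number instead.
χ : Subset n → Fin n → ℕ
χ A v = if lookup A v then 1 else 0

χ-∈ : {A : Subset n} {v : Fin n} → v ∈ A → χ A v ≡ 1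
χ-∈ v∈A rewrite []=⇒lookup v∈A = refl

χ-∉ : {A : Subset n} {v : Fin n} → v ∉ A → χ A v ≡ 0
χ-∉ {A = A} {v} v∉A with lookup A v in eq
... | true  = contradiction (lookup⇒[]= v A eq) v∉A
... | false = refl

χ-∩ : (A B : Subset n) (v : Fin n) → χ (A ∩ B) v ≡ χ A v * χ B v
χ-∩ (true  ∷ A) (true  ∷ B) zero    = refl
χ-∩ (true  ∷ A) (false ∷ B) zero    = refl
χ-∩ (false ∷ A) (_     ∷ B) zero    = refl
χ-∩ (_     ∷ A) (_     ∷ B) (suc v) = χ-∩ A B v

Σχ : (A : Subset n) → Σ[ χ A ] ≡ ∣ A ∣
Σχ []          = refl
Σχ (true  ∷ A) = cong suc (Σχ A)
Σχ (false ∷ A) = Σχ A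

subsingleton⇒∣p∣≤1 : {A : Subset n} → (∀ {u v} → u ∈ A → v ∈ A → u ≡ v) → ∣ A ∣ ≤ 1
subsingleton⇒∣p∣≤1 {n} {A} prop with nonempty? A
... | yes (x , x∈A) = subst (∣ A ∣ ≤_) (∣⁅x⁆∣≡1 x)
                        (p⊆q⇒∣p∣≤∣q∣ λ v∈A → subst (_∈ ⁅ x ⁆) (prop x∈A v∈A) (x∈⁅x⁆ x))
... | no  empty     = subst (_≤ 1) (sym (trans (cong ∣_∣ (Empty-unique empty)) (∣⊥∣≡0 n))) z≤n

∣p∣≤∣p─q∣+∣p∩q∣ : (p q : Subset n) → ∣ p ∣ ≤ ∣ p ─ q ∣ + ∣ p ∩ q ∣
∣p∣≤∣p─q∣+∣p∩q∣ []          []          = z≤n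
∣p∣≤∣p─q∣+∣p∩q∣ (true  ∷ p) (true  ∷ q) = subst (suc ∣ p ∣ ≤_) (sym (ℕ.+-suc _ _)) (s≤s (∣p∣≤∣p─q∣+∣p∩q∣ p q))
∣p∣≤∣p─q∣+∣p∩q∣ (true  ∷ p) (false ∷ q) = s≤s (∣p∣≤∣p─q∣+∣p∩q∣ p q)
∣p∣≤∣p─q∣+∣p∩q∣ (false ∷ p) (true  ∷ q) = ∣p∣≤∣p─q∣+∣p∩q∣ p q
∣p∣≤∣p─q∣+∣p∩q∣ (false ∷ p) (false ∷ q) = ∣p∣≤∣p─q∣+∣p∩q∣ p q

x∈p─q⇒x∉q : {p q : Subset n} {x : Fin n} → x ∈ p ─ q → x ∉ q
x∈p─q⇒x∉q {p = true ∷ p} {true ∷ q} {zero} ()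
x∈p─q⇒x∉q {p = true ∷ p} {false ∷ q} {zero} here ()
x∈p─q⇒x∉q {p = _ ∷ p} {_ ∷ q} {suc x} (there x∈) (there x∈q) = x∈p─q⇒x∉q {p = p} x∈ x∈q

subsets : (n : ℕ) → List (Subset n)
subsets zero    = [] ∷ []
subsets (suc n) = map (inside ∷_) (subsets n) ++ map (outside ∷_) (subsets n)

∈-subsets : (A : Subset n) → A ∈ₗ subsets n
∈-subsets []          = here refl
∈-subsets (true  ∷ A) = ∈-++⁺ˡ (∈-map⁺ _ (∈-subsets A))
∈-subsets (false ∷ A) = ∈-++⁺ʳ _ (∈-map⁺ _ (∈-subsets A))

-- Weighted colourings and the weak perfect graph theorem

count : List (Subset n) → Fin n → ℕ
count []       v = 0
count (A ∷ As) v = χ A v + count As v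

weight : (Fin n → ℕ) → Subset n → ℕ
weight h K = Σ[ (λ v → χ K v * h v) ]

weight-mono : {g h : Fin n → ℕ} (K : Subset n) → (∀ {v} → v ∈ K → g v ≤ h v) → weight g K ≤ weight h K
weight-mono {g = g} {h} K g≤h = Σ-mono λ v → [ inK v , outK v ]′ (side v)
  where
  side : ∀ v → v ∈ K ⊎ v ∉ K
  side v with v ∈? K
  ... | yes p = inj₁ p
  ... | no ¬p = inj₂ ¬p
  inK : ∀ v → v ∈ K → χ K v * g v ≤ χ K v * h v
  inK v v∈K = ℕ.*-monoʳ-≤ (χ K v) (g≤h v∈K)
  outK : ∀ v → v ∉ K → χ K v * g v ≤ χ K v * h v
  outK v v∉K rewrite χ-∉ v∉K = z≤n

weight-mono-< : {g h : Fin n → ℕ} (K : Subset n) → (∀ v → g v ≤ h v) →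
                ∀ {u} → u ∈ K → g u < h u → weight g K < weight h K
weight-mono-< {g = g} {h} K g≤h {u} u∈K gu<hu =
  Σ-mono-< (λ v → ℕ.*-monoʳ-≤ (χ K v) (g≤h v)) u
    (subst (λ k → k * g u < k * h u) (sym (χ-∈ u∈K)) (ℕ.*-monoʳ-< 1 gu<hu))

weight-count : (K A : Subset n) (As : List (Subset n)) →
               weight (count (A ∷ As)) K ≡ ∣ K ∩ A ∣ + weight (count As) K
weight-count K A As = begin
  Σ[ (λ v → χ K v * (χ A v + count As v)) ]           ≡⟨ sum-cong-≗ ℕ.+-0-commutativeMonoid (λ v → ℕ.*-distribˡ-+ (χ K v) _ _) ⟩
  Σ[ (λ v → χ K v * χ A v + χ K v * count As v) ]     ≡⟨ ∑-distrib-+ ℕ.+-0-commutativeMonoid (λ v → χ K v * χ A v) _ ⟩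
  Σ[ (λ v → χ K v * χ A v) ] + weight (count As) K    ≡⟨ cong (_+ weight (count As) K) (sum-cong-≗ ℕ.+-0-commutativeMonoid (λ v → sym (χ-∩ K A v))) ⟩
  Σ[ χ (K ∩ A) ] + weight (count As) K                ≡⟨ cong (_+ weight (count As) K) (Σχ (K ∩ A)) ⟩
  ∣ K ∩ A ∣ + weight (count As) K                     ∎
  where open ≡-Reasoning

∈⇒1≤count : {As : List (Subset n)} {A : Subset n} {v : Fin n} → A ∈ₗ As → v ∈ A → 1 ≤ count As v
∈⇒1≤count {v = v} (here refl) v∈A rewrite χ-∈ v∈A = s≤s z≤n
∈⇒1≤count (there A∈) v∈A = ℕ.≤-trans (∈⇒1≤count A∈ v∈A) (ℕ.m≤n+m _ _)

-- Splits one member through `v` off a multiset of sets. Only the length and the counts of what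
-- remains matter later, so no permutation is recorded.
record Extraction (As : List (Subset n)) (v : Fin n) (P : Subset n → Set) : Set where
  field
    A      : Subset n
    rest   : List (Subset n)
    v∈A    : v ∈ A
    P-A    : P A
    P-rest : All P rest
    length≡ : length As ≡ suc (length rest)
    count≡ : ∀ u → count As u ≡ χ A u + count rest u

extract : {P : Subset n → Set} (As : List (Subset n)) (v : Fin n) →
          All P As → 1 ≤ count As v → Extraction As v P
extract (A ∷ As) v (pA ∷ pAs) 1≤ with v ∈? A
... | yes v∈A = record { A = A ; rest = As ; v∈A = v∈A ; P-A = pA ; P-rest = pAs
                       ; length≡ = refl ; count≡ = λ u → refl }
... | no  v∉A = record
  { A = E.A ; rest = A ∷ E.rest ; v∈A = E.v∈A ; P-A = E.P-A ; P-rest = pA ∷ E.P-rest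
  ; length≡ = cong suc E.length≡
  ; count≡ = λ u → begin
      χ A u + count As u                   ≡⟨ cong (χ A u +_) (E.count≡ u) ⟩
      χ A u + (χ E.A u + count E.rest u)   ≡⟨ ℕ.+-assoc (χ A u) _ _ ⟨
      χ A u + χ E.A u + count E.rest u     ≡⟨ cong (_+ count E.rest u) (ℕ.+-comm (χ A u) _) ⟩
      χ E.A u + χ A u + count E.rest u     ≡⟨ ℕ.+-assoc (χ E.A u) _ _ ⟩
      χ E.A u + (χ A u + count E.rest u)   ∎ }
  where
  open ≡-Reasoning
  module E = Extraction (extract As v pAs (subst (1 ≤_) (cong (_+ count As v) (χ-∉ v∉A)) 1≤))

module Graph {n : ℕ} (_~_ : Fin n → Fin n → Set) (_~?_ : ∀ u v → Dec (u ~ v)) where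

  Clique : Subset n → Set
  Clique K = ∀ {u v} → u ∈ K → v ∈ K → u ≢ v → u ~ v

  Independent : Subset n → Set
  Independent A = ∀ {u v} → u ∈ A → v ∈ A → ¬ u ~ v

  clique? : Decidable Clique
  clique? K = map′ (λ f u∈ v∈ → f _ _ u∈ v∈) (λ f _ _ → f)
    (all? λ u → all? λ v → u ∈? K →-dec (v ∈? K →-dec (¬? (u ≟ v) →-dec (u ~? v))))

  independent? : Decidable Independent
  independent? A = map′ (λ f u∈ v∈ → f _ _ u∈ v∈) (λ f _ _ → f)
    (all? λ u → all? λ v → u ∈? A →-dec (v ∈? A →-dec ¬? (u ~? v)))

  clique∩independent : ∀ {K A} → Clique K → Independent A → ∣ K ∩ A ∣ ≤ 1
  clique∩independent {K} {A} clique indep = subsingleton⇒∣p∣≤1 λ {u} {v} u∈ v∈ →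
    let u∈K , u∈A = x∈p∩q⁻ K A u∈ ; v∈K , v∈A = x∈p∩q⁻ K A v∈ in
    decidable-stable (u ≟ v) λ u≢v → indep u∈A v∈A (clique u∈K v∈K u≢v)

  IndependentIn : Subset n → Subset n → Set
  IndependentIn W A = A ⊆ W × Independent A

  -- An independent set meets a clique at most once; this is ω ≤ χ in weighted form.
  weight-count≤length : ∀ {W K As} → Clique K → All (IndependentIn W) As → weight (count As) K ≤ length As
  weight-count≤length {K = K} clique [] = ℕ.≤-reflexive (trans
    (sum-cong-≗ ℕ.+-0-commutativeMonoid λ v → ℕ.*-zeroʳ (χ K v))
    (sum-replicate-zero ℕ.+-0-commutativeMonoid n))
  weight-count≤length {K = K} {A ∷ As} clique ((_ , indep) ∷ indeps) = ℕ.≤-trans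
    (ℕ.≤-reflexive (weight-count K A As))
    (ℕ.+-mono-≤ (clique∩independent clique indep) (weight-count≤length clique indeps))

  -- The existence of both a proper k-colouring and a clique of size k says χ = ω = k.
  record χ≡ω (W : Subset n) : Set where
    field
      k        : ℕ
      colour   : Fin n → ℕ
      colour<k : ∀ {v} → v ∈ W → colour v < k
      proper   : ∀ {u v} → u ∈ W → v ∈ W → u ~ v → colour u ≢ colour v
      K        : Subset n
      K⊆W      : K ⊆ W
      clique   : Clique K
      k≤∣K∣    : k ≤ ∣ K ∣

  Perfect : Subset n → Set
  Perfect W = ∀ W′ → W′ ⊆ W → χ≡ω W′

  -- χ = ω for the graph in which each `v` is replaced by `h v` independent copies. `covers` is only
  -- an inequality, so classes never have to be trimmed.
  record WeightedColouring (W : Subset n) (h : Fin n → ℕ) : Set where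
    field
      classes : List (Subset n)
      indep   : All (IndependentIn W) classes
      covers  : ∀ v → h v ≤ count classes v
      K       : Subset n
      K⊆W     : K ⊆ W
      clique  : Clique K
      length≤ : length classes ≤ weight h K

  module _ {W : Subset n} (perfect : Perfect W) where

    -- For weights 0 and 1 this is perfection, applied to the support of `h`.
    weightedColouring₁ : (h : Fin n → ℕ) → (∀ v → v ∉ W → h v ≡ 0) → (∀ v → h v ≤ 1) → WeightedColouring W h
    weightedColouring₁ h supp h≤1 = record
      { classes = map class (upTo P.k)
      ; indep   = All.map⁺ (All.universal class-indep (upTo P.k))
      ; covers  = covers
      ; K       = P.K
      ; K⊆W     = U⊆W ∘ P.K⊆W
      ; clique  = P.clique
      ; length≤ = begin
          length (map class (upTo P.k))  ≡⟨ length-map class (upTo P.k) ⟩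
          length (upTo P.k)              ≡⟨ length-upTo P.k ⟩
          P.k                            ≤⟨ P.k≤∣K∣ ⟩
          ∣ P.K ∣                        ≡⟨ Σχ P.K ⟨
          Σ[ χ P.K ]                     ≡⟨ sum-cong-≗ ℕ.+-0-commutativeMonoid (λ v → sym (ℕ.*-identityʳ (χ P.K v))) ⟩
          weight (λ _ → 1) P.K           ≤⟨ weight-mono P.K (λ v∈K → ℕ.≤-reflexive (sym (∈-sift⁻ U? (P.K⊆W v∈K)))) ⟩
          weight h P.K                   ∎
      }
      where
      open ℕ.≤-Reasoning
      U? : Decidable (λ v → h v ≡ 1)
      U? v = h v ℕ.≟ 1
      U : Subset n
      U = sift U?
      U⊆W : U ⊆ W
      U⊆W {v} v∈U = decidable-stable (v ∈? W) λ v∉W →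
        contradiction (trans (sym (supp v v∉W)) (∈-sift⁻ U? v∈U)) λ ()
      module P = χ≡ω (perfect U U⊆W)
      class? : ∀ c → Decidable (λ v → v ∈ U × P.colour v ≡ c)
      class? c v = (v ∈? U) ×-dec (P.colour v ℕ.≟ c)
      class : ℕ → Subset n
      class c = sift (class? c)
      class-indep : ∀ c → IndependentIn W (class c)
      class-indep c = U⊆W ∘ proj₁ ∘ ∈-sift⁻ (class? c) , λ u∈ v∈ u~v →
        let u∈U , u≡c = ∈-sift⁻ (class? c) u∈ ; v∈U , v≡c = ∈-sift⁻ (class? c) v∈ in
        P.proper u∈U v∈U u~v (trans u≡c (sym v≡c))
      covers : ∀ v → h v ≤ count (map class (upTo P.k)) v
      covers v with h v ℕ.≟ 1
      ... | yes hv≡1 = ℕ.≤-trans (h≤1 v)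
        (∈⇒1≤count (∈-map⁺ class (∈-upTo⁺ (P.colour<k v∈U))) (∈-sift⁺ (class? _) (v∈U , refl)))
        where v∈U = ∈-sift⁺ U? hv≡1
      ... | no  hv≢1 = ℕ.≤-trans (s≤s⁻¹ (ℕ.≤∧≢⇒< (h≤1 v) hv≢1)) z≤n

    -- Lovász's replication argument: raising the weight of v by one costs a new
    -- colour only if v lies on a heaviest clique; otherwise a class through v
    -- can be used twice at v.
    weightedColouring : (h : Fin n → ℕ) → (∀ v → v ∉ W → h v ≡ 0) → Acc _<_ Σ[ h ] → WeightedColouring W h
    weightedColouring h supp (acc rec) with any? (λ v → 2 ≤? h v)
    ... | no  none = weightedColouring₁ h supp λ v → ℕ.≮⇒≥ (λ 1<hv → none (v , 1<hv))
    ... | yes (v , 2≤hv) = extend (anySubset? λ K → clique? K ×-dec (K ⊆? W) ×-dec (suc k ≤? weight h K))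
      where
      h′ : Fin n → ℕ
      h′ = updateAt h v pred
      h′v : suc (h′ v) ≡ h v
      h′v = trans (cong suc (updateAt-updates v h))
                  (ℕ.suc-pred (h v) {{>-nonZero (ℕ.≤-trans (s≤s z≤n) 2≤hv)}})
      h′-other : ∀ {u} → u ≢ v → h′ u ≡ h u
      h′-other u≢v = updateAt-minimal _ v h u≢v
      h′≤h : ∀ u → h′ u ≤ h u
      h′≤h u with u ≟ v
      ... | yes refl = ℕ.≤-trans (ℕ.n≤1+n _) (ℕ.≤-reflexive h′v)
      ... | no  u≢v  = ℕ.≤-reflexive (h′-other u≢v)
      supp′ : ∀ {g : Fin n → ℕ} → (∀ u → g u ≤ h u) → ∀ u → u ∉ W → g u ≡ 0
      supp′ g≤h u u∉W = ℕ.n≤0⇒n≡0 (subst (_ ≤_) (supp u u∉W) (g≤h u))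
      Σh′<Σh : Σ[ h′ ] < Σ[ h ]
      Σh′<Σh = Σ-mono-< h′≤h v (ℕ.≤-reflexive h′v)
      v∈W : v ∈ W
      v∈W = decidable-stable (v ∈? W) λ v∉W → contradiction (subst (2 ≤_) (supp v v∉W) 2≤hv) λ ()

      module C = WeightedColouring (weightedColouring h′ (supp′ h′≤h) (rec Σh′<Σh))
      k = length C.classes

      -- Since `2 ≤ h v`, the lowered weight of `v` is still positive, so some class passes through
      -- `v`.
      module E = Extraction (extract C.classes v C.indep
        (ℕ.≤-trans (s≤s⁻¹ (subst (2 ≤_) (sym h′v) 2≤hv)) (C.covers v)))

      -- What remains to be covered once `A` is used: `A` serves one unit of `h′` at each of its
      -- vertices, except at `v`, where it serves the unit that `h` has beyond `h′`.
      h″ : Fin n → ℕ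
      h″ = updateAt (λ u → h′ u ∸ χ E.A u) v (λ _ → h′ v)
      h″v : h″ v ≡ h′ v
      h″v = updateAt-updates v (λ u → h′ u ∸ χ E.A u)
      h″-other : ∀ {u} → u ≢ v → h″ u ≡ h′ u ∸ χ E.A u
      h″-other u≢v = updateAt-minimal _ v (λ u → h′ u ∸ χ E.A u) u≢v
      h″≤h′ : ∀ u → h″ u ≤ h′ u
      h″≤h′ u with u ≟ v
      ... | yes refl = ℕ.≤-reflexive h″v
      ... | no  u≢v  = subst (_≤ h′ u) (sym (h″-other u≢v)) (ℕ.m∸n≤m (h′ u) (χ E.A u))
      h≤h″+χ : ∀ u → h u ≤ χ E.A u + h″ u
      h≤h″+χ u with u ≟ v
      ... | yes refl = ℕ.≤-reflexive (sym (trans (cong₂ _+_ (χ-∈ E.v∈A) h″v) h′v))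
      ... | no  u≢v  = ℕ.≤-trans (ℕ.≤-reflexive (sym (h′-other u≢v))) (ℕ.≤-trans (ℕ.m≤n+m∸n (h′ u) (χ E.A u))
                         (ℕ.+-monoʳ-≤ (χ E.A u) (ℕ.≤-reflexive (sym (h″-other u≢v)))))

      extend : Dec (∃[ K ] (Clique K × K ⊆ W × suc k ≤ weight h K)) → WeightedColouring W h
      extend (yes (K , clique , K⊆W , k<weight)) = record
        { classes = ⁅ v ⁆ ∷ C.classes
        ; indep   = ((λ u∈ → subst (_∈ W) (sym (x∈⁅y⁆⇒x≡y v u∈)) v∈W) , singleton) ∷ C.indep
        ; covers  = covers
        ; K = K ; K⊆W = K⊆W ; clique = clique ; length≤ = k<weight }
        where
        singleton : Independent ⁅ v ⁆
        singleton u∈ w∈ u~w with x∈⁅y⁆⇒x≡y v u∈ | x∈⁅y⁆⇒x≡y v w∈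
        ... | refl | refl = proj₂ E.P-A E.v∈A E.v∈A u~w
        covers : ∀ u → h u ≤ χ ⁅ v ⁆ u + count C.classes u
        covers u with u ≟ v
        ... | yes refl = ℕ.≤-trans (ℕ.≤-reflexive (sym h′v)) (ℕ.≤-trans (s≤s (C.covers v))
                           (ℕ.≤-reflexive (cong (_+ count C.classes v) (sym (χ-∈ (x∈⁅x⁆ v))))))
        ... | no  u≢v  = ℕ.≤-trans (ℕ.≤-reflexive (sym (h′-other u≢v))) (ℕ.≤-trans (C.covers u) (ℕ.m≤n+m _ _))
      extend (no light) = record
        { classes = E.A ∷ C″.classes
        ; indep   = E.P-A ∷ C″.indep
        ; covers  = λ u → ℕ.≤-trans (h≤h″+χ u) (ℕ.+-monoʳ-≤ (χ E.A u) (C″.covers u))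
        ; K = C.K ; K⊆W = C.K⊆W ; clique = C.clique
        ; length≤ = begin
            suc (length C″.classes)  ≤⟨ s≤s C″.length≤ ⟩
            suc (weight h″ C″.K)     ≤⟨ s≤s (lighter C″.clique C″.K⊆W) ⟩
            suc (length E.rest)      ≡⟨ E.length≡ ⟨
            k                        ≤⟨ C.length≤ ⟩
            weight h′ C.K            ≤⟨ weight-mono C.K (λ {u} _ → h′≤h u) ⟩
            weight h C.K             ∎ }
        where
        open ℕ.≤-Reasoning
        module C″ = WeightedColouring (weightedColouring h″
          (supp′ λ u → ℕ.≤-trans (h″≤h′ u) (h′≤h u)) (rec (ℕ.≤-<-trans (Σ-mono h″≤h′) Σh′<Σh)))
        weight≤k : ∀ {K} → Clique K → K ⊆ W → weight h K ≤ suc (length E.rest)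
        weight≤k clique K⊆W = subst (_ ≤_) E.length≡ (ℕ.≮⇒≥ λ k< → light (_ , clique , K⊆W , k<))
        -- No clique is heavier than k under `h`, and one unit is lost under `h″`: at `v` if `v` is
        -- in `K`, else at a vertex of `A` in `K` with positive weight. If there is no such vertex,
        -- the remaining k - 1 classes already cover `h″` on `K`.
        lighter : ∀ {K} → Clique K → K ⊆ W → weight h″ K ≤ length E.rest
        lighter {K} clique K⊆W with v ∈? K
        ... | yes v∈K = s≤s⁻¹ (begin
          suc (weight h″ K)     ≤⟨ s≤s (weight-mono K λ {u} _ → h″≤h′ u) ⟩
          suc (weight h′ K)     ≤⟨ weight-mono-< K h′≤h v∈K (ℕ.≤-reflexive h′v) ⟩
          weight h K            ≤⟨ weight≤k clique K⊆W ⟩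
          suc (length E.rest)   ∎)
        ... | no v∉K with any? (λ u → (u ∈? K) ×-dec (u ∈? E.A) ×-dec (1 ≤? h′ u))
        ...   | yes (u , u∈K , u∈A , 1≤h′u) = s≤s⁻¹ (begin
          suc (weight h″ K)     ≤⟨ weight-mono-< K h″≤h′ u∈K h″u<h′u ⟩
          weight h′ K           ≤⟨ weight-mono K (λ {u} _ → h′≤h u) ⟩
          weight h K            ≤⟨ weight≤k clique K⊆W ⟩
          suc (length E.rest)   ∎)
          where
          h″u<h′u : h″ u < h′ u
          h″u<h′u = ℕ.≤-reflexive (trans
            (cong suc (trans (h″-other λ u≡v → v∉K (subst (_∈ K) u≡v u∈K)) (cong (h′ u ∸_) (χ-∈ u∈A))))
            (ℕ.m+[n∸m]≡n 1≤h′u))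
        ...   | no none = begin
          weight h″ K               ≤⟨ weight-mono K h″≤rest ⟩
          weight (count E.rest) K   ≤⟨ weight-count≤length clique E.P-rest ⟩
          length E.rest             ∎
          where
          h″≤rest : ∀ {u} → u ∈ K → h″ u ≤ count E.rest u
          h″≤rest {u} u∈K with u ∈? E.A
          ... | yes u∈A = ℕ.≤-trans (h″≤h′ u) (ℕ.≤-trans (s≤s⁻¹ (ℕ.≰⇒> λ 1≤ → none (u , u∈K , u∈A , 1≤))) z≤n)
          ... | no  u∉A = ℕ.≤-trans (h″≤h′ u) (ℕ.≤-trans (C.covers u)
                  (ℕ.≤-reflexive (trans (E.count≡ u) (cong (_+ count E.rest u) (χ-∉ u∉A)))))

  record MaximumIn (W S : Subset n) : Set where
    field
      S⊆W     : S ⊆ W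
      indep   : Independent S
      maximum : ∀ {A} → IndependentIn W A → ∣ A ∣ ≤ ∣ S ∣

  Meets : Subset n → Subset n → Set
  Meets A K = ∃[ v ] (v ∈ A × v ∈ K)

  meets? : ∀ A K → Dec (Meets A K)
  meets? A K = any? λ v → (v ∈? A) ×-dec (v ∈? K)

  Avoidable : Subset n → Subset n → Subset n → Set
  Avoidable W S K = ∃[ A ] (IndependentIn W A × ∣ S ∣ ≤ ∣ A ∣ × ¬ Meets A K)

  avoidable? : ∀ W S K → Dec (Avoidable W S K)
  avoidable? W S K = anySubset? λ A →
    ((A ⊆? W) ×-dec independent? A) ×-dec (∣ S ∣ ≤? ∣ A ∣) ×-dec ¬? (meets? A K)

  -- If every clique P were avoided by some maximum independent set, weighting
  -- each vertex by the number of chosen sets through it would contradict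
  -- the weighted colouring, whose size is the weight of some clique.
  hittingClique : ∀ {W S} → Perfect W → Nonempty W → MaximumIn W S →
                  ∃[ K ] (Clique K × K ⊆ W × (∀ {A} → IndependentIn W A → ∣ S ∣ ≤ ∣ A ∣ → Meets A K))
  hittingClique {W} {S} perfect (w , w∈W) max with anySubset? (λ K →
    clique? K ×-dec (K ⊆? W) ×-dec ¬? (avoidable? W S K))
  ... | yes (K , clique , K⊆W , none) = K , clique , K⊆W , λ {A} A∈ S≤A →
    decidable-stable (meets? A K) λ avoids → none (A , A∈ , S≤A , avoids)
  -- Double counting of `h`: one set of size at least |S| is chosen per subset, while a class has
  -- size at most |S|. So there are at least as many classes as subsets, yet their number is at most
  -- the weight of a clique, which is smaller.
  ... | no none = contradiction (ℕ.*-cancelˡ-≤ ∣ S ∣ {{>-nonZero 0<∣S∣}} chain) (ℕ.<⇒≱ fewer)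
    where
    open MaximumIn max
    record Avoider (K : Subset n) : Set where
      field
        A       : Subset n
        A∈      : IndependentIn W A
        S≤A     : ∣ S ∣ ≤ ∣ A ∣
        avoids  : Clique K × K ⊆ W → ¬ Meets A K
    avoider : ∀ K → Avoider K
    avoider K with (clique? K) ×-dec (K ⊆? W)
    -- `S` is a filler that lets the family be indexed by all subsets; it has the required size.
    ... | no  ¬K = record { A = S ; A∈ = S⊆W , indep ; S≤A = ℕ.≤-refl ; avoids = λ clique∈ → contradiction clique∈ ¬K }
    ... | yes (c , K⊆W) with avoidable? W S K
    ...   | yes (A , A∈ , S≤A , avoids) = record { A = A ; A∈ = A∈ ; S≤A = S≤A ; avoids = λ _ → avoids }
    ...   | no  hit = ⊥-elim (none (K , c , K⊆W , hit))
    family : List (Subset n) → List (Subset n)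
    family = map (Avoider.A ∘ avoider)
    As = family (subsets n)
    h = count As
    family-indep : ∀ Ks → All (IndependentIn W) (family Ks)
    family-indep Ks = All.map⁺ (All.universal (Avoider.A∈ ∘ avoider) Ks)
    supp : ∀ {As} → All (IndependentIn W) As → ∀ v → v ∉ W → count As v ≡ 0
    supp []                  v v∉W = refl
    supp ((A⊆W , _) ∷ indep) v v∉W = cong₂ _+_ (χ-∉ (v∉W ∘ A⊆W)) (supp indep v v∉W)
    module C = WeightedColouring
      (weightedColouring perfect h (supp (family-indep (subsets n))) (<-wellFounded _))
    -- Each chosen set adds at most one to the weight of `K`, and the set chosen for `K` itself adds
    -- nothing.
    lacks : ∀ {K} Ks → Clique K → K ⊆ W → K ∈ₗ Ks → weight (count (family Ks)) K < length Ks
    lacks {K} (.K ∷ Ks) clique K⊆W (here refl) = begin-strict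
      weight (count (A ∷ family Ks)) K             ≡⟨ weight-count K A (family Ks) ⟩
      ∣ K ∩ A ∣ + weight (count (family Ks)) K     ≡⟨ cong (_+ weight (count (family Ks)) K) empty ⟩
      weight (count (family Ks)) K                 ≤⟨ weight-count≤length clique (family-indep Ks) ⟩
      length (family Ks)                           ≡⟨ length-map _ Ks ⟩
      length Ks                                    <⟨ ℕ.n<1+n _ ⟩
      suc (length Ks)                              ∎
      where
      open ℕ.≤-Reasoning
      A = Avoider.A (avoider K)
      empty : ∣ K ∩ A ∣ ≡ 0
      empty = trans (cong ∣_∣ (Empty-unique λ (v , v∈) → let v∈K , v∈A = x∈p∩q⁻ K A v∈ in
                Avoider.avoids (avoider K) (clique , K⊆W) (v , v∈A , v∈K))) (∣⊥∣≡0 n)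
    lacks {K} (K′ ∷ Ks) clique K⊆W (there K∈) = begin-strict
      weight (count (A ∷ family Ks)) K             ≡⟨ weight-count K A (family Ks) ⟩
      ∣ K ∩ A ∣ + weight (count (family Ks)) K     <⟨ ℕ.+-mono-≤-< (clique∩independent clique (proj₂ (Avoider.A∈ (avoider K′))))
                                                       (lacks Ks clique K⊆W K∈) ⟩
      suc (length Ks)                              ∎
      where
      open ℕ.≤-Reasoning
      A = Avoider.A (avoider K′)
    Σcount : ∀ A As → Σ[ count (A ∷ As) ] ≡ ∣ A ∣ + Σ[ count As ]
    Σcount A As = trans (∑-distrib-+ ℕ.+-0-commutativeMonoid (χ A) (count As)) (cong (_+ Σ[ count As ]) (Σχ A))
    lower : ∀ Ks → ∣ S ∣ * length Ks ≤ Σ[ count (family Ks) ]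
    lower []       = ℕ.≤-trans (ℕ.≤-reflexive (ℕ.*-zeroʳ ∣ S ∣)) z≤n
    lower (K ∷ Ks) = begin
      ∣ S ∣ * suc (length Ks)                  ≡⟨ ℕ.*-suc ∣ S ∣ _ ⟩
      ∣ S ∣ + ∣ S ∣ * length Ks                ≤⟨ ℕ.+-mono-≤ (Avoider.S≤A (avoider K)) (lower Ks) ⟩
      ∣ Avoider.A (avoider K) ∣ + Σ[ count (family Ks) ]  ≡⟨ Σcount (Avoider.A (avoider K)) (family Ks) ⟨
      Σ[ count (family (K ∷ Ks)) ]             ∎
      where open ℕ.≤-Reasoning
    upper : ∀ {As} → All (IndependentIn W) As → Σ[ count As ] ≤ ∣ S ∣ * length As
    upper [] = ℕ.≤-trans (ℕ.≤-reflexive (sum-replicate-zero ℕ.+-0-commutativeMonoid n)) z≤n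
    upper {A ∷ As} (A∈ ∷ indep) = begin
      Σ[ count (A ∷ As) ]          ≡⟨ Σcount A As ⟩
      ∣ A ∣ + Σ[ count As ]        ≤⟨ ℕ.+-mono-≤ (maximum A∈) (upper indep) ⟩
      ∣ S ∣ + ∣ S ∣ * length As    ≡⟨ ℕ.*-suc ∣ S ∣ _ ⟨
      ∣ S ∣ * suc (length As)      ∎
      where open ℕ.≤-Reasoning
    fewer : length C.classes < length (subsets n)
    fewer = ℕ.≤-<-trans C.length≤ (lacks (subsets n) C.clique C.K⊆W (∈-subsets C.K))
    chain : ∣ S ∣ * length (subsets n) ≤ ∣ S ∣ * length C.classes
    chain = ℕ.≤-trans (lower (subsets n)) (ℕ.≤-trans (Σ-mono C.covers) (upper C.indep))
    0<∣S∣ : 0 < ∣ S ∣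
    0<∣S∣ = subst (_≤ ∣ S ∣) (∣⁅x⁆∣≡1 w) (maximum (⁅w⁆⊆W , indep-⁅w⁆))
      where
      ⁅w⁆⊆W : ⁅ w ⁆ ⊆ W
      ⁅w⁆⊆W v∈ = subst (_∈ W) (sym (x∈⁅y⁆⇒x≡y w v∈)) w∈W
      indep-⁅w⁆ : Independent ⁅ w ⁆
      indep-⁅w⁆ u∈ v∈ u~v with x∈⁅y⁆⇒x≡y w u∈ | x∈⁅y⁆⇒x≡y w v∈
      -- Irreflexivity within `W` is read off from a proper colouring.
      ... | refl | refl = χ≡ω.proper (perfect W id) w∈W w∈W u~v refl

  -- The cliques are the fibres of `owner` in `W`, each labelled by its vertex of `S`; disjointness
  -- is then automatic.
  record CliqueCover (W S : Subset n) : Set where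
    field
      owner        : Fin n → Fin n
      owner∈S      : ∀ {v} → v ∈ W → owner v ∈ S
      owner-S      : ∀ {s} → s ∈ S → owner s ≡ s
      owner-clique : ∀ {u v} → u ∈ W → v ∈ W → owner u ≡ owner v → u ≢ v → u ~ v

  -- A clique that meets all maximum independent sets lowers the independence number when it is
  -- removed. It meets `S` in exactly one vertex, so what is left of `S` is again maximum.
  cliqueCover : ∀ {W S} → Perfect W → MaximumIn W S → Acc _<_ ∣ W ∣ → CliqueCover W S
  cliqueCover {W} {S} perfect max (acc rec) with nonempty? W
  ... | no  empty = record
    { owner = id
    ; owner∈S = λ v∈W → contradiction (_ , v∈W) empty
    ; owner-S = λ _ → refl
    ; owner-clique = λ u∈W → contradiction (_ , u∈W) empty }
  ... | yes nonempty with hittingClique perfect nonempty max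
  ...   | K , clique , K⊆W , hits with hits {S} (MaximumIn.S⊆W max , MaximumIn.indep max) ℕ.≤-refl
  ...     | s , s∈S , s∈K = record
    { owner = owner ; owner∈S = owner∈S ; owner-S = owner-S ; owner-clique = owner-clique }
    where
    open MaximumIn max
    s-only : ∀ {t} → t ∈ S → t ∈ K → s ≡ t
    s-only {t} t∈S t∈K = decidable-stable (s ≟ t) λ s≢t → indep s∈S t∈S (clique s∈K t∈K s≢t)
    ∣S∣≤ : ∣ S ∣ ≤ suc ∣ S ─ K ∣
    ∣S∣≤ = begin
      ∣ S ∣                      ≤⟨ ∣p∣≤∣p─q∣+∣p∩q∣ S K ⟩
      ∣ S ─ K ∣ + ∣ S ∩ K ∣      ≤⟨ ℕ.+-monoʳ-≤ ∣ S ─ K ∣ (subsingleton⇒∣p∣≤1 λ u∈ v∈ →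
                                     let u∈S , u∈K = x∈p∩q⁻ S K u∈ ; v∈S , v∈K = x∈p∩q⁻ S K v∈ in
                                     trans (sym (s-only u∈S u∈K)) (s-only v∈S v∈K)) ⟩
      ∣ S ─ K ∣ + 1              ≡⟨ ℕ.+-comm _ 1 ⟩
      suc ∣ S ─ K ∣              ∎
      where open ℕ.≤-Reasoning
    max′ : MaximumIn (W ─ K) (S ─ K)
    max′ = record
      { S⊆W     = λ v∈ → x∈p∧x∉q⇒x∈p─q (S⊆W (p─q⊆p S K v∈)) (x∈p─q⇒x∉q {p = S} v∈)
      ; indep   = λ u∈ v∈ → indep (p─q⊆p S K u∈) (p─q⊆p S K v∈)
      ; maximum = λ {A} (A⊆ , A-indep) → s≤s⁻¹ (ℕ.≤-trans
          (ℕ.≰⇒> λ S≤A → let v , v∈A , v∈K = hits (p─q⊆p W K ∘ A⊆ , A-indep) S≤A in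
            x∈p─q⇒x∉q {p = W} (A⊆ v∈A) v∈K)
          ∣S∣≤) }
    module C = CliqueCover (cliqueCover (λ W′ W′⊆ → perfect W′ (p─q⊆p W K ∘ W′⊆)) max′
      (rec (p∩q≢∅⇒∣p─q∣<∣p∣ W K (s , x∈p∩q⁺ (S⊆W s∈S , s∈K)))))
    owner : Fin n → Fin n
    owner v with v ∈? K
    ... | yes _ = s
    ... | no  _ = C.owner v
    owner∈S : ∀ {v} → v ∈ W → owner v ∈ S
    owner∈S {v} v∈W with v ∈? K
    ... | yes _   = s∈S
    ... | no  v∉K = p─q⊆p S K (C.owner∈S (x∈p∧x∉q⇒x∈p─q v∈W v∉K))
    owner-S : ∀ {t} → t ∈ S → owner t ≡ t
    owner-S {t} t∈S with t ∈? K
    ... | yes t∈K = s-only t∈S t∈K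
    ... | no  t∉K = C.owner-S (x∈p∧x∉q⇒x∈p─q t∈S t∉K)
    s≢C : ∀ {v} → v ∈ W → v ∉ K → s ≢ C.owner v
    s≢C v∈W v∉K s≡ = x∈p─q⇒x∉q {p = S} (subst (_∈ S ─ K) (sym s≡) (C.owner∈S (x∈p∧x∉q⇒x∈p─q v∈W v∉K))) s∈K
    owner-clique : ∀ {u v} → u ∈ W → v ∈ W → owner u ≡ owner v → u ≢ v → u ~ v
    owner-clique {u} {v} u∈W v∈W eq u≢v with u ∈? K | v ∈? K
    ... | yes u∈K | yes v∈K = clique u∈K v∈K u≢v
    ... | yes u∈K | no  v∉K = contradiction eq (s≢C v∈W v∉K)
    ... | no  u∉K | yes v∈K = contradiction (sym eq) (s≢C u∈W u∉K)
    ... | no  u∉K | no  v∉K = C.owner-clique (x∈p∧x∉q⇒x∈p─q u∈W u∉K) (x∈p∧x∉q⇒x∈p─q v∈W v∉K) eq u≢v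

-- Deletion of a vertex, decidable reachability, pigeonhole

x∉p-x : (p : Subset n) (x : Fin n) → x ∉ p - x
x∉p-x p x x∈ = x∈p─q⇒x∉q {p = p} x∈ (x∈⁅x⁆ x)

p-x⊆p : (p : Subset n) (x : Fin n) → p - x ⊆ p
p-x⊆p p x = p─q⊆p p ⁅ x ⁆

module _ {R : Fin n → Fin n → Set} (R? : ∀ u v → Dec (R u v)) where

  private
    module _ (x : Fin n) where
      closure : ∀ A → Acc _<_ ∣ ∁ A ∣ → (∀ {v} → v ∈ A → Star R x v) → x ∈ A →
                ∃[ B ] ((∀ {v} → v ∈ B → Star R x v) × (∀ {v} → Star R x v → v ∈ B))
      closure A (acc rec) sound x∈A
        with any? (λ u → any? λ v → (u ∈? A) ×-dec ¬? (v ∈? A) ×-dec R? u v)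
      ... | yes (u , v , u∈A , v∉A , Ruv) =
            closure (A ∪ ⁅ v ⁆) (rec (p⊂q⇒∣p∣<∣q∣ (shrinks , v , x∉p⇒x∈∁p v∉A , λ v∈ → x∈∁p⇒x∉p v∈ v∈A∪v)))
              sound′ (p⊆p∪q ⁅ v ⁆ x∈A)
        where
        v∈A∪v : v ∈ A ∪ ⁅ v ⁆
        v∈A∪v = q⊆p∪q A ⁅ v ⁆ (x∈⁅x⁆ v)
        shrinks : ∁ (A ∪ ⁅ v ⁆) ⊆ ∁ A
        shrinks w∈ = x∉p⇒x∈∁p λ w∈A → x∈∁p⇒x∉p w∈ (p⊆p∪q ⁅ v ⁆ w∈A)
        sound′ : ∀ {w} → w ∈ A ∪ ⁅ v ⁆ → Star R x w
        sound′ w∈ with x∈p∪q⁻ A ⁅ v ⁆ w∈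
        ... | inj₁ w∈A = sound w∈A
        ... | inj₂ w∈v = subst (Star R x) (sym (x∈⁅y⁆⇒x≡y v w∈v)) (sound u∈A ◅◅ (Ruv ◅ ε))
      ... | no closed = A , sound , complete x∈A
        where
        complete : ∀ {u v} → u ∈ A → Star R u v → v ∈ A
        complete u∈A ε = u∈A
        complete {u} u∈A (_◅_ {j = v} Ruv vs) =
          complete (decidable-stable (v ∈? A) λ v∉A → closed (u , v , u∈A , v∉A , Ruv)) vs

  abstract
    star? : ∀ x v → Dec (Star R x v)
    star? x v with closure x ⁅ x ⁆ (<-wellFounded _)
                     (λ v∈ → subst (Star R x) (sym (x∈⁅y⁆⇒x≡y x v∈)) ε) (x∈⁅x⁆ x)
    ... | B , sound , complete = map′ sound complete (v ∈? B)

surjection⇒k≤∣p∣ : ∀ k (f : Fin n → ℕ) (A : Subset n) →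
                   (∀ {c} → c < k → ∃[ v ] (v ∈ A × f v ≡ c)) → k ≤ ∣ A ∣
surjection⇒k≤∣p∣ zero    f A onto = z≤n
surjection⇒k≤∣p∣ (suc k) f A onto with onto (ℕ.n<1+n k)
... | x , x∈A , fx≡k = ℕ.≤-trans (s≤s (surjection⇒k≤∣p∣ k f (A - x) onto′)) (x∈p⇒∣p-x∣<∣p∣ x∈A)
  where
  onto′ : ∀ {c} → c < k → ∃[ v ] (v ∈ A - x × f v ≡ c)
  onto′ c<k with onto (ℕ.m<n⇒m<1+n c<k)
  ... | v , v∈A , fv≡c = v , x∈p∧x≢y⇒x∈p-y v∈A (λ { refl → ℕ.<-irrefl (trans (sym fv≡c) fx≡k) c<k }) , fv≡c

-- Reductions that preserve χ = ω

module DigraphGraph {n : ℕ} (D : Digraph n) where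

  infix 4 _⇒_ _⇒?_ _~_ _~?_ _≃_

  _⇒_ _~_ _≃_ : Fin n → Fin n → Set
  _⇒_ = Edge D
  _~_ = Adjacent D
  u ≃ v = u ~ v ⊎ u ≡ v

  _⇒?_ : ∀ u v → Dec (u ⇒ v)
  u ⇒? v = T? (edge D u v)

  _~?_ : ∀ u v → Dec (u ~ v)
  u ~? v = (u ⇒? v) ⊎-dec (v ⇒? u)

  _≃?_ : ∀ u v → Dec (u ≃ v)
  u ≃? v = (u ~? v) ⊎-dec (u ≟ v)

  ~-sym : ∀ {u v} → u ~ v → v ~ u
  ~-sym = swap

  ~-irrefl : ∀ {v} → ¬ v ~ v
  ~-irrefl = [ loopless D _ , loopless D _ ]′

  ≃-sym : ∀ {u v} → u ≃ v → v ≃ u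
  ≃-sym = [ inj₁ ∘ swap , inj₂ ∘ sym ]′

  ≃⇒~ : ∀ {u v} → u ≢ v → u ≃ v → u ~ v
  ≃⇒~ u≢v = [ id , ⊥-elim ∘ u≢v ]′

  ⇒⇒≢ : ∀ {u v} → u ⇒ v → u ≢ v
  ⇒⇒≢ u⇒u refl = loopless D _ u⇒u

  open Graph _~_ _~?_ public

  module _ {W : Subset n} {p : Fin n} where

    private
      -- Common form of the reductions by one vertex: `p` receives a colour `c` absent from its
      -- neighbourhood, and `K′` certifies the new number of colours.
      recolour : (P : χ≡ω (W - p)) (let open χ≡ω P) (k′ c : ℕ) → k ≤ k′ → c < k′ →
                 (∀ {v} → v ∈ W → v ~ p → colour v ≢ c) →
                 (K′ : Subset n) → K′ ⊆ W → Clique K′ → k′ ≤ ∣ K′ ∣ → χ≡ω W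
      recolour P k′ c k≤k′ c<k′ free K′ K′⊆W clique′ k′≤∣K′∣ = record
        { k = k′ ; colour = colour′ ; colour<k = colour′<k′ ; proper = proper′
        ; K = K′ ; K⊆W = K′⊆W ; clique = clique′ ; k≤∣K∣ = k′≤∣K′∣ }
        where
        open χ≡ω P
        colour′ : Fin n → ℕ
        colour′ v with v ≟ p
        ... | yes _ = c
        ... | no  _ = colour v
        colour′<k′ : ∀ {v} → v ∈ W → colour′ v < k′
        colour′<k′ {v} v∈W with v ≟ p
        ... | yes _  = c<k′
        ... | no v≢p = ℕ.<-≤-trans (colour<k (x∈p∧x≢y⇒x∈p-y v∈W v≢p)) k≤k′
        proper′ : ∀ {u v} → u ∈ W → v ∈ W → u ~ v → colour′ u ≢ colour′ v
        proper′ {u} {v} u∈W v∈W u~v with u ≟ p | v ≟ p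
        ... | yes refl | yes refl = contradiction u~v ~-irrefl
        ... | yes refl | no  v≢p  = free v∈W (~-sym u~v) ∘ sym
        ... | no  u≢p  | yes refl = free u∈W u~v
        ... | no  u≢p  | no  v≢p  = proper (x∈p∧x≢y⇒x∈p-y u∈W u≢p) (x∈p∧x≢y⇒x∈p-y v∈W v≢p) u~v

      ~⇒∈ : ∀ {v} → v ∈ W → v ~ p → v ∈ W - p
      ~⇒∈ v∈W v~p = x∈p∧x≢y⇒x∈p-y v∈W λ { refl → ~-irrefl v~p }

    dominated : ∀ {q} → q ∈ W → p ≢ q → ¬ p ~ q → (∀ {z} → z ∈ W → z ~ p → z ~ q) → χ≡ω (W - p) → χ≡ω W
    dominated {q} q∈W p≢q p≁q N⊆ P =
      recolour P k (colour q) ℕ.≤-refl (colour<k q∈)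
        (λ v∈W v~p → proper (~⇒∈ v∈W v~p) q∈ (N⊆ v∈W v~p))
        K (p-x⊆p W p ∘ K⊆W) clique k≤∣K∣
      where
      open χ≡ω P
      q∈ = x∈p∧x≢y⇒x∈p-y q∈W (p≢q ∘ sym)

    universal : p ∈ W → (∀ {v} → v ∈ W → v ≃ p) → χ≡ω (W - p) → χ≡ω W
    universal p∈W near P =
      recolour P (suc k) k (ℕ.n≤1+n k) (ℕ.n<1+n k)
        (λ v∈W v~p → ℕ.<⇒≢ (colour<k (~⇒∈ v∈W v~p)))
        (K ∪ ⁅ p ⁆) K∪p⊆W clique′
        (ℕ.≤-trans (s≤s k≤∣K∣) (p⊂q⇒∣p∣<∣q∣ (p⊆p∪q ⁅ p ⁆ , p , q⊆p∪q K ⁅ p ⁆ (x∈⁅x⁆ p) , x∉p-x W p ∘ K⊆W)))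
      where
      open χ≡ω P
      K∪p⊆W : K ∪ ⁅ p ⁆ ⊆ W
      K∪p⊆W v∈ with x∈p∪q⁻ K ⁅ p ⁆ v∈
      ... | inj₁ v∈K = p-x⊆p W p (K⊆W v∈K)
      ... | inj₂ v∈p rewrite x∈⁅y⁆⇒x≡y p v∈p = p∈W
      clique′ : Clique (K ∪ ⁅ p ⁆)
      clique′ {u} {v} u∈ v∈ u≢v with x∈p∪q⁻ K ⁅ p ⁆ u∈ | x∈p∪q⁻ K ⁅ p ⁆ v∈
      ... | inj₁ u∈K | inj₁ v∈K = clique u∈K v∈K u≢v
      ... | inj₁ u∈K | inj₂ v∈p rewrite x∈⁅y⁆⇒x≡y p v∈p = ≃⇒~ u≢v (near (p-x⊆p W p (K⊆W u∈K)))
      ... | inj₂ u∈p | inj₁ v∈K rewrite x∈⁅y⁆⇒x≡y p u∈p = ~-sym (≃⇒~ (u≢v ∘ sym) (near (p-x⊆p W p (K⊆W v∈K))))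
      ... | inj₂ u∈p | inj₂ v∈p = contradiction (trans (x∈⁅y⁆⇒x≡y p u∈p) (sym (x∈⁅y⁆⇒x≡y p v∈p))) u≢v

    -- Either some colour is missing on the neighbourhood and is given to `p`, or all k colours
    -- occur there, and then the closed neighbourhood is a clique of more than k vertices that pays
    -- for a new colour.
    simplicial : p ∈ W → (∀ {u v} → u ∈ W → v ∈ W → u ~ p → v ~ p → u ≃ v) → χ≡ω (W - p) → χ≡ω W
    simplicial p∈W N-clique P with anyUpTo? (λ c → all? λ v → v ∈? W →-dec (v ~? p →-dec ¬? (χ≡ω.colour P v ℕ.≟ c))) (χ≡ω.k P)
    ... | yes (c , c<k , free) =
      recolour P k c ℕ.≤-refl c<k (λ {v} v∈W v~p → free v v∈W v~p) K (p-x⊆p W p ∘ K⊆W) clique k≤∣K∣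
      where open χ≡ω P
    ... | no taken =
      recolour P (suc k) k (ℕ.n≤1+n k) (ℕ.n<1+n k)
        (λ v∈W v~p → ℕ.<⇒≢ (colour<k (~⇒∈ v∈W v~p)))
        N[p] (proj₁ ∘ ∈-sift⁻ N[p]?) N[p]-clique
        (ℕ.≤-trans (s≤s (surjection⇒k≤∣p∣ k colour (N[p] - p) onto))
          (x∈p⇒∣p-x∣<∣p∣ (∈-sift⁺ N[p]? (p∈W , inj₂ refl))))
      where
      open χ≡ω P
      N[p]? : Decidable (λ v → v ∈ W × v ≃ p)
      N[p]? v = (v ∈? W) ×-dec (v ≃? p)
      N[p] = sift N[p]?
      N[p]-clique : Clique N[p]
      N[p]-clique {u} {v} u∈ v∈ u≢v with ∈-sift⁻ N[p]? u∈ | ∈-sift⁻ N[p]? v∈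
      ... | u∈W , inj₁ u~p  | v∈W , inj₁ v~p  = ≃⇒~ u≢v (N-clique u∈W v∈W u~p v~p)
      ... | u∈W , inj₁ u~p  | v∈W , inj₂ refl = u~p
      ... | u∈W , inj₂ refl | v∈W , inj₁ v~p  = ~-sym v~p
      ... | u∈W , inj₂ refl | v∈W , inj₂ refl = contradiction refl u≢v
      onto : ∀ {c} → c < k → ∃[ v ] (v ∈ N[p] - p × colour v ≡ c)
      onto {c} c<k with any? (λ v → (v ∈? W) ×-dec (v ~? p) ×-dec (colour v ℕ.≟ c))
      ... | yes (v , v∈W , v~p , eq) =
        v , x∈p∧x≢y⇒x∈p-y (∈-sift⁺ N[p]? (v∈W , inj₁ v~p)) (λ { refl → ~-irrefl v~p }) , eq
      ... | no none = ⊥-elim (taken (c , c<k , λ v v∈W v~p eq → none (v , v∈W , v~p , eq)))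

  module Union {W C} (closed : ∀ {u v} → u ∈ C → v ∈ W → u ~ v → v ∈ C)
               (P : χ≡ω C) (Q : χ≡ω (W ─ C)) where
    module P = χ≡ω P
    module Q = χ≡ω Q

    colour : Fin n → ℕ
    colour v with v ∈? C
    ... | yes _ = P.colour v
    ... | no  _ = Q.colour v

    colour<k : ∀ {v} → v ∈ W → colour v < P.k ⊔ Q.k
    colour<k {v} v∈W with v ∈? C
    ... | yes v∈C = ℕ.<-≤-trans (P.colour<k v∈C) (ℕ.m≤m⊔n P.k Q.k)
    ... | no  v∉C = ℕ.<-≤-trans (Q.colour<k (x∈p∧x∉q⇒x∈p─q v∈W v∉C)) (ℕ.m≤n⊔m P.k Q.k)

    proper : ∀ {u v} → u ∈ W → v ∈ W → u ~ v → colour u ≢ colour v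
    proper {u} {v} u∈W v∈W u~v with u ∈? C | v ∈? C
    ... | yes u∈C | yes v∈C = P.proper u∈C v∈C u~v
    ... | yes u∈C | no  v∉C = contradiction (closed u∈C v∈W u~v) v∉C
    ... | no  u∉C | yes v∈C = contradiction (closed v∈C u∈W (~-sym u~v)) u∉C
    ... | no  u∉C | no  v∉C = Q.proper (x∈p∧x∉q⇒x∈p─q u∈W u∉C) (x∈p∧x∉q⇒x∈p─q v∈W v∉C) u~v

  union : ∀ {W C} → (∀ {u v} → u ∈ C → v ∈ W → u ~ v → v ∈ C) → C ⊆ W →
          χ≡ω C → χ≡ω (W ─ C) → χ≡ω W
  union {W} {C} closed C⊆W P Q with ℕ.⊔-sel (χ≡ω.k P) (χ≡ω.k Q)
  ... | inj₁ k≡P = record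
    { colour<k = colour<k ; proper = proper
    ; K⊆W = C⊆W ∘ P.K⊆W ; clique = P.clique ; k≤∣K∣ = subst (_≤ ∣ P.K ∣) (sym k≡P) P.k≤∣K∣ }
    where open Union closed P Q
  ... | inj₂ k≡Q = record
    { colour<k = colour<k ; proper = proper
    ; K⊆W = p─q⊆p W C ∘ Q.K⊆W ; clique = Q.clique ; k≤∣K∣ = subst (_≤ ∣ Q.K ∣) (sym k≡Q) Q.k≤∣K∣ }
    where open Union closed P Q

  bipartite : ∀ {W} {P : Fin n → Set} (P? : Decidable P) →
              (∀ {u v} → u ∈ W → v ∈ W → u ⇒ v → P u → ¬ P v) →
              (∀ {u v} → u ∈ W → v ∈ W → u ⇒ v → ¬ P u → ¬ ¬ P v) → χ≡ω W
  bipartite {W} P? in⇒out out⇒in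
    with any? (λ u → any? λ v → (u ∈? W) ×-dec (v ∈? W) ×-dec (u ~? v))
  ... | yes (u , v , u∈W , v∈W , u~v) = record
    { colour = colour ; colour<k = λ {v} _ → colour<2 v ; proper = proper′
    ; K = ⁅ u ⁆ ∪ ⁅ v ⁆ ; K⊆W = [ (λ { refl → u∈W }) , (λ { refl → v∈W }) ]′ ∘ cases ; clique = clique
    ; k≤∣K∣ = subst (λ k → suc k ≤ ∣ ⁅ u ⁆ ∪ ⁅ v ⁆ ∣) (∣⁅x⁆∣≡1 u) (p⊂q⇒∣p∣<∣q∣
        (p⊆p∪q ⁅ v ⁆ , v , q⊆p∪q ⁅ u ⁆ ⁅ v ⁆ (x∈⁅x⁆ v) ,
         λ v∈ → ~-irrefl (subst (_~ v) (sym (x∈⁅y⁆⇒x≡y u v∈)) u~v))) }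
    where
    colour : Fin n → ℕ
    colour v = if does (P? v) then 0 else 1
    colour<2 : ∀ v → colour v < 2
    colour<2 v with does (P? v)
    ... | true  = s≤s z≤n
    ... | false = s≤s (s≤s z≤n)
    proper : ∀ {u v} → u ∈ W → v ∈ W → u ⇒ v → colour u ≢ colour v
    proper {u} {v} u∈W v∈W u⇒v with P? u | P? v
    ... | yes pu | yes pv = contradiction pv (in⇒out u∈W v∈W u⇒v pu)
    ... | yes _  | no  _  = λ ()
    ... | no  _  | yes _  = λ ()
    ... | no ¬pu | no ¬pv = contradiction ¬pv (out⇒in u∈W v∈W u⇒v ¬pu)
    proper′ : ∀ {u v} → u ∈ W → v ∈ W → u ~ v → colour u ≢ colour v
    proper′ u∈W v∈W (inj₁ u⇒v) = proper u∈W v∈W u⇒v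
    proper′ u∈W v∈W (inj₂ v⇒u) = proper v∈W u∈W v⇒u ∘ sym
    cases : ∀ {w} → w ∈ ⁅ u ⁆ ∪ ⁅ v ⁆ → w ≡ u ⊎ w ≡ v
    cases = [ inj₁ ∘ x∈⁅y⁆⇒x≡y u , inj₂ ∘ x∈⁅y⁆⇒x≡y v ]′ ∘ x∈p∪q⁻ ⁅ u ⁆ ⁅ v ⁆
    clique : Clique (⁅ u ⁆ ∪ ⁅ v ⁆)
    clique x∈ y∈ x≢y with cases x∈ | cases y∈
    ... | inj₁ refl | inj₁ refl = contradiction refl x≢y
    ... | inj₁ refl | inj₂ refl = u~v
    ... | inj₂ refl | inj₁ refl = ~-sym u~v
    ... | inj₂ refl | inj₂ refl = contradiction refl x≢y
  -- Without edges ω is 1, or 0 if `W` is empty, and the number of colours has to drop with it.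
  ... | no edgeless with nonempty? W
  ...   | yes (w , w∈W) = record
    { colour = λ _ → 0 ; colour<k = λ _ → s≤s z≤n
    ; proper = λ u∈W v∈W u~v → ⊥-elim (edgeless (_ , _ , u∈W , v∈W , u~v))
    ; K = ⁅ w ⁆ ; K⊆W = λ v∈ → subst (_∈ W) (sym (x∈⁅y⁆⇒x≡y w v∈)) w∈W
    ; clique = λ u∈ v∈ u≢v → contradiction (trans (x∈⁅y⁆⇒x≡y w u∈) (sym (x∈⁅y⁆⇒x≡y w v∈))) u≢v
    ; k≤∣K∣ = ℕ.≤-reflexive (sym (∣⁅x⁆∣≡1 w)) }
  ...   | no empty = record
    { colour = λ _ → 0 ; colour<k = λ v∈W → ⊥-elim (empty (_ , v∈W))
    ; proper = λ u∈W → ⊥-elim (empty (_ , u∈W))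
    ; K = ⊥ ; K⊆W = λ v∈ → contradiction v∈ ∉⊥
    ; clique = λ u∈ → contradiction u∈ ∉⊥ ; k≤∣K∣ = z≤n }

-- Auxiliary facts on numbers, lists and subsets

halve : ∀ d → ∃[ e ] (d ≡ e + e ⊎ d ≡ suc (e + e))
halve zero = 0 , inj₁ refl
halve (suc d) with halve d
... | e , inj₁ refl = e , inj₂ refl
... | e , inj₂ refl = suc e , inj₁ (cong suc (sym (ℕ.+-suc e e)))

least : {P : ℕ → Set} → Decidable P → ∀ {k} → P k → ∃[ m ] (P m × (∀ {j} → P j → m ≤ j))
least {P} P? p = go (<-wellFounded _) p
  where
  go : ∀ {k} → Acc _<_ k → P k → ∃[ m ] (P m × (∀ {j} → P j → m ≤ j))
  go {k} (acc rec) pk with anyUpTo? P? k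
  ... | yes (j , j<k , pj) = go (rec j<k) pj
  ... | no  none = k , pk , λ pj → ℕ.≮⇒≥ λ j<k → none (_ , j<k , pj)

lookup-injective : {A : Set} {xs : List A} → AllPairs _≢_ xs → ∀ {i j} → lookupₗ xs i ≡ lookupₗ xs j → i ≡ j
lookup-injective (_ ∷ _)   {zero}  {zero}  _  = refl
lookup-injective (x∉ ∷ _)  {zero}  {suc j} eq = contradiction eq (All.lookup x∉ (∈-lookup j))
lookup-injective (x∉ ∷ _)  {suc i} {zero}  eq = contradiction (sym eq) (All.lookup x∉ (∈-lookup i))
lookup-injective (_ ∷ xs!) {suc i} {suc j} eq = cong suc (lookup-injective xs! eq)

last-∷ : {A : Set} (x y : A) (zs : List A) → last (x ∷ y ∷ zs) ≡ last (y ∷ zs)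
last-∷ x y zs with initLast zs
... | []        = refl
... | ys ∷ʳ′ z = refl

last-∷ʳ : {A : Set} (xs : List A) (x : A) → last (xs ∷ʳ x) ≡ x
last-∷ʳ []           x = refl
last-∷ʳ (y ∷ [])     x = refl
last-∷ʳ (y ∷ z ∷ zs) x = trans (last-∷ y z (zs ++ x ∷ [])) (last-∷ʳ (z ∷ zs) x)

toList-∷ʳ : {A : Set} (xs : List A) (x : A) → toList (xs ∷ʳ x) ≡ xs ++ x ∷ []
toList-∷ʳ []       x = refl
toList-∷ʳ (y ∷ ys) x = refl

∣p∣+∣q∣≤∣p∪q∣ : (p q : Subset n) → (∀ {v} → v ∈ p → v ∉ q) → ∣ p ∣ + ∣ q ∣ ≤ ∣ p ∪ q ∣
∣p∣+∣q∣≤∣p∪q∣ []          []          disjoint = z≤n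
∣p∣+∣q∣≤∣p∪q∣ (true  ∷ p) (true  ∷ q) disjoint = contradiction here (disjoint here)
∣p∣+∣q∣≤∣p∪q∣ (true  ∷ p) (false ∷ q) disjoint =
  s≤s (∣p∣+∣q∣≤∣p∪q∣ p q λ v∈p v∈q → disjoint (there v∈p) (there v∈q))
∣p∣+∣q∣≤∣p∪q∣ (false ∷ p) (true  ∷ q) disjoint = ℕ.≤-trans (ℕ.≤-reflexive (ℕ.+-suc ∣ p ∣ ∣ q ∣))
  (s≤s (∣p∣+∣q∣≤∣p∪q∣ p q λ v∈p v∈q → disjoint (there v∈p) (there v∈q)))
∣p∣+∣q∣≤∣p∪q∣ (false ∷ p) (false ∷ q) disjoint =
  ∣p∣+∣q∣≤∣p∪q∣ p q λ v∈p v∈q → disjoint (there v∈p) (there v∈q)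

-- A constant alternative can be pulled out of the quantifier because there are finitely many
-- subsets; `P` need not be decidable.
allSubsets-⊎ : {P : Set} {Q : Subset n → Set} → (∀ A → P ⊎ Q A) → P ⊎ (∀ A → Q A)
allSubsets-⊎ {zero}  f with f []
... | inj₁ p = inj₁ p
... | inj₂ q = inj₂ λ { [] → q }
allSubsets-⊎ {suc n} f with allSubsets-⊎ (f ∘ (inside ∷_)) | allSubsets-⊎ (f ∘ (outside ∷_))
... | inj₁ p | _      = inj₁ p
... | inj₂ _ | inj₁ p = inj₁ p
... | inj₂ q | inj₂ r = inj₂ λ { (true ∷ A) → q A ; (false ∷ A) → r A }

-- Holes in arc-locally out-semicomplete digraphs

module LocallyOutSemicomplete {n : ℕ} (D : Digraph n) (alos : ArcLocallyOutSemicomplete D)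
  (nontransitive : ∀ {a b c} → Edge D a b → Edge D b c → Edge D a c → Edge D b a ⊎ Edge D c b ⊎ Edge D c a)
  where

  open DigraphGraph D

  -- c runs periodically through the L vertices; d = L − 1 in chordless rules out
  -- reversed arcs.
  record Hole (W : Subset n) : Set where
    field
      K         : ℕ
      2≤K       : 2 ≤ K
    L : ℕ
    L = suc (K + K)
    field
      c         : ℕ → Fin n
      c∈W       : ∀ i → c i ∈ W
      period    : ∀ i → c (L + i) ≡ c i
      c⇒c       : ∀ i → c i ⇒ c (suc i)
      chordless : ∀ i d → 2 ≤ d → d < L → ¬ c i ⇒ c (d + i)

  hole-mono : ∀ {W W′} → W′ ⊆ W → Hole W′ → Hole W
  hole-mono W′⊆W H = record
    { K = K ; 2≤K = 2≤K ; c = c ; c∈W = W′⊆W ∘ c∈W ; period = period ; c⇒c = c⇒c ; chordless = chordless }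
    where open Hole H

  -- Initial components, walks and shortest odd closed walks

  module Within (W : Subset n) where

    Step Reach : Fin n → Fin n → Set
    Step u v = u ∈ W × v ∈ W × u ⇒ v
    Reach = Star Step

    step? : ∀ u v → Dec (Step u v)
    step? u v = (u ∈? W) ×-dec (v ∈? W) ×-dec (u ⇒? v)

    reach? : ∀ u v → Dec (Reach u v)
    reach? = star? step?

    Initial : Fin n → Set
    Initial v = ∀ u → Reach u v → Reach v u

    initial? : Decidable Initial
    initial? v = all? λ u → reach? u v →-dec reach? v u

    -- An ancestor that `v` does not reach back has fewer ancestors: `v` itself is lost.
    initialAncestor : ∀ v → Acc _<_ ∣ sift (λ u → reach? u v) ∣ → ∃[ p ] (Reach p v × Initial p)
    initialAncestor v (acc rec) with any? (λ u → reach? u v ×-dec ¬? (reach? v u))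
    ... | no  none = v , ε , λ u u↝v → decidable-stable (reach? v u) λ v↝̸u → none (u , u↝v , v↝̸u)
    ... | yes (u , u↝v , v↝̸u) =
      let p , p↝u , init = initialAncestor u (rec (p⊂q⇒∣p∣<∣q∣
            ( (λ w∈ → ∈-sift⁺ (λ w → reach? w v) (∈-sift⁻ (λ w → reach? w u) w∈ ◅◅ u↝v))
            , v , ∈-sift⁺ (λ w → reach? w v) ε , v↝̸u ∘ ∈-sift⁻ (λ w → reach? w u))))
      in p , p↝u ◅◅ u↝v , init

    data Walk : ℕ → Fin n → Fin n → Set where
      []  : ∀ {v} → Walk 0 v v
      _∷_ : ∀ {k u v w} → Step u v → Walk k v w → Walk (suc k) u w

    _++ʷ_ : ∀ {j k u v w} → Walk j u v → Walk k v w → Walk (j + k) u w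
    []      ++ʷ ys = ys
    (x ∷ xs) ++ʷ ys = x ∷ (xs ++ʷ ys)

    walk? : ∀ k u v → Dec (Walk k u v)
    walk? zero    u v = map′ (λ { refl → [] }) (λ { [] → refl }) (u ≟ v)
    walk? (suc k) u w = map′ (λ (v , s , ws) → s ∷ ws) (λ { (s ∷ ws) → _ , s , ws })
                          (any? λ v → step? u v ×-dec walk? k v w)

    reach⇒walk : ∀ {u v} → Reach u v → ∃[ k ] Walk k u v
    reach⇒walk ε        = 0 , []
    reach⇒walk (s ◅ ss) = let k , ws = reach⇒walk ss in suc k , s ∷ ws

    -- Turns a closed walk into a periodic sequence indexed by ℕ, as `Hole` requires. A state is the
    -- nonempty rest of the walk; when it is used up, `closed` starts again.
    module Unroll {m x} (closed : Walk (suc m) x x) where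

      record State : Set where
        constructor state
        field
          {at}   : Fin n
          {left} : ℕ
          walk   : Walk (suc left) at x

      next : State → State
      next (state (_ ∷ []))         = state closed
      next (state (_ ∷ (s ∷ walk))) = state (s ∷ walk)

      run : ℕ → State → State
      run zero    s = s
      run (suc i) s = run i (next s)

      run-+ : ∀ i j s → run (i + j) s ≡ run j (run i s)
      run-+ zero    j s = refl
      run-+ (suc i) j s = run-+ i j (next s)

      run-out : ∀ {j u} (walk : Walk (suc j) u x) → run (suc j) (state walk) ≡ state closed
      run-out (_ ∷ [])        = refl
      run-out (_ ∷ (s ∷ walk)) = run-out (s ∷ walk)

      vertex : ℕ → Fin n
      vertex i = State.at (run i (state closed))

      period : ∀ i → vertex (suc m + i) ≡ vertex i
      period i = cong State.at (trans (run-+ (suc m) i (state closed)) (cong (run i) (run-out closed)))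

      step : ∀ i → Step (vertex i) (vertex (suc i))
      step i = go i (state closed)
        where
        go : ∀ i s → Step (State.at (run i s)) (State.at (run (suc i) s))
        go (suc i) s                          = go i (next s)
        go zero    (state (s ∷ []))           = now closed s
          where
          now : ∀ {j u} (walk : Walk (suc j) x x) → Step u x → Step u (State.at (state walk))
          now walk s = s
        go zero    (state (s ∷ (_ ∷ _)))      = s

    -- A shortest odd closed walk of length at least 5 has no chords, since by
    -- local out-semicompleteness an even chord forces a shorter one further on.
    module Shortest {q x} (closed : Walk (suc ((2 + q) + (2 + q))) x x)
                    (shortest : ∀ {k} → ∃[ y ] Walk (suc (k + k)) y y → 2 + q ≤ k) where

      open Unroll closed renaming (vertex to c)
      K L : ℕ
      K = 2 + q
      L = suc (K + K)

      c⇒c : ∀ i → c i ⇒ c (suc i)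
      c⇒c i = proj₂ (proj₂ (step i))

      along : ∀ m i → Walk m (c i) (c (m + i))
      along zero    i = []
      along (suc m) i = step i ∷ subst (λ j → Walk m (c (suc i)) (c j)) (ℕ.+-suc m i) (along m (suc i))

      back : ∀ m d i → m + d ≡ L → Walk m (c (d + i)) (c i)
      back m d i eq = subst (λ v → Walk m (c (d + i)) v)
        (trans (cong c (trans (sym (ℕ.+-assoc m d i)) (cong (_+ i) eq))) (period i)) (along m (d + i))

      tooShort : ∀ {k m y} {A : Set} → k < K → m ≡ suc (k + k) → Walk m y y → A
      tooShort k<K refl walk = contradiction (shortest (_ , walk)) (ℕ.<⇒≱ k<K)

      chord : ∀ i j → c i ⇒ c j → Step (c i) (c j)
      chord i j i⇒j = proj₁ (step i) , proj₁ (step j) , i⇒j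

      -- A chord over an odd stretch can replace it: the closed walk keeps its parity and becomes
      -- shorter.
      noOddChord : ∀ f e i → K ≡ f + suc e → ¬ c i ⇒ c (suc (suc e + suc e) + i)
      noOddChord f e i K≡ i⇒ = tooShort {k = f} (subst (f <_) (sym K≡) (ℕ.m<m+n f (s≤s z≤n))) refl
        (chord i (suc (suc e + suc e) + i) i⇒ ∷ back (f + f) (suc (suc e + suc e)) i (trans (eq f e) (cong (λ k → suc (k + k)) (sym K≡))))
        where
        eq : ∀ f e → f + f + suc (suc e + suc e) ≡ suc ((f + suc e) + (f + suc e))
        eq = solve-∀

      -- Local out-semicompleteness relates `c (1 + i)` and `c (3 + i)`. A backward arc would close
      -- a directed triangle, and equality would cut two arcs off the walk.
      jump : ∀ i → c i ⇒ c (2 + i) → c (1 + i) ⇒ c (3 + i)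
      jump i i⇒ with alos i⇒ (c⇒c i) (c⇒c (2 + i))
      ... | inj₁ (inj₁ arc) = arc
      ... | inj₁ (inj₂ arc) = tooShort {k = 1} (s≤s (s≤s z≤n)) refl (step (1 + i) ∷ step (2 + i) ∷ chord (3 + i) (1 + i) arc ∷ [])
      ... | inj₂ c₁≡c₃ = tooShort {k = suc q} (ℕ.n<1+n _) refl
        (subst (λ v → Walk _ v (c (1 + i))) (sym c₁≡c₃) (back (suc (suc q + suc q)) 2 (1 + i) (eq q)))
        where
        eq : ∀ q → suc (suc q + suc q) + 2 ≡ suc (suc (suc q) + suc (suc q))
        eq = solve-∀

      -- Descent on the length of the chord: its head is compared with `c (2 + i)`. An arc from
      -- there to the head is an even chord shorter by two; the reversed arc or an equality yields a
      -- shorter odd closed walk.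
      noEvenChord : ∀ f e i → K ≡ f + suc e → ¬ c i ⇒ c ((suc e + suc e) + i)
      -- By `jump`, a second chord of length 2 starts where the first one ends; two arcs then
      -- replace four, leaving the odd length L - 2.
      noEvenChord f zero i K≡ i⇒ = tooShort {k = suc q} (ℕ.n<1+n _) (len q)
        (chord i (2 + i) i⇒ ∷ chord (2 + i) (4 + i) (jump (1 + i) (jump i i⇒)) ∷ back (suc (q + q)) 4 i (eq q))
        where
        len : ∀ q → 2 + suc (q + q) ≡ suc (suc q + suc q)
        len = solve-∀
        eq : ∀ q → suc (q + q) + 4 ≡ suc (suc (suc q) + suc (suc q))
        eq = solve-∀
      noEvenChord f (suc e) i K≡ i⇒ with alos (c⇒c i) i⇒ (c⇒c (1 + i))
      ... | inj₁ (inj₁ arc) = tooShort {k = suc e} (subst (suc e <_) (sym K≡) (ℕ.m≤n+m _ f)) (ℕ.+-comm (suc e + suc e) 1)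
        (along (suc e + suc e) (2 + i) ++ʷ
          (subst (λ j → Step (c j) (c (2 + i))) (eq e i) (chord ((suc (suc e) + suc (suc e)) + i) (2 + i) arc) ∷ []))
        where
        eq : ∀ e i → (suc (suc e) + suc (suc e)) + i ≡ (suc e + suc e) + (2 + i)
        eq = solve-∀
      ... | inj₁ (inj₂ arc) = noEvenChord (suc f) e (2 + i) (trans K≡ (ℕ.+-suc f (suc e)))
        (subst (λ j → c (2 + i) ⇒ c j) (eq e i) arc)
        where
        eq : ∀ e i → (suc (suc e) + suc (suc e)) + i ≡ (suc e + suc e) + (2 + i)
        eq = solve-∀
      ... | inj₂ c≡ = tooShort {k = suc f} (subst (suc f <_) (sym K≡) (lt f e)) (len f)
        (subst (λ v → Walk _ v (c (2 + i))) c≡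
          (back (suc (f + f)) (suc (suc e) + suc (suc e)) i (trans (eq f e) (cong (λ k → suc (k + k)) (sym K≡))) ++ʷ (step i ∷ step (1 + i) ∷ [])))
        where
        lt : ∀ f e → suc f < f + suc (suc e)
        lt f e = subst (suc f <_) (sym (trans (ℕ.+-suc f (suc e)) (cong suc (ℕ.+-suc f e)))) (s≤s (s≤s (ℕ.m≤m+n f e)))
        len : ∀ f → suc (f + f) + 2 ≡ suc (suc f + suc f)
        len = solve-∀
        eq : ∀ f e → suc (f + f) + (suc (suc e) + suc (suc e)) ≡ suc ((f + suc (suc e)) + (f + suc (suc e)))
        eq = solve-∀

      chordless : ∀ i d → 2 ≤ d → d < L → ¬ c i ⇒ c (d + i)
      chordless i d 2≤d d<L with halve d
      ... | zero  , inj₁ refl = contradiction 2≤d λ ()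
      ... | suc e , inj₁ refl = noEvenChord (K ∸ suc e) e i (sym (ℕ.m∸n+n≡m (halved d<L)))
        where
        halved : suc e + suc e < L → suc e ≤ K
        halved lt = ℕ.≮⇒≥ λ K<e → ℕ.<-irrefl refl (ℕ.<-≤-trans lt
          (ℕ.≤-trans (ℕ.n≤1+n _) (ℕ.≤-trans (ℕ.≤-reflexive (cong suc (sym (ℕ.+-suc K K)))) (ℕ.+-mono-≤ K<e K<e))))
      ... | zero  , inj₂ refl = contradiction 2≤d λ { (s≤s ()) }
      ... | suc e , inj₂ refl = noOddChord (K ∸ suc e) e i (sym (ℕ.m∸n+n≡m (halved (s≤s⁻¹ d<L))))
        where
        halved : suc e + suc e < K + K → suc e ≤ K
        halved lt = ℕ.≮⇒≥ λ K<e → ℕ.<-irrefl refl (ℕ.<-≤-trans lt (ℕ.+-mono-≤ (ℕ.<⇒≤ K<e) (ℕ.<⇒≤ K<e)))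

      hole : Hole W
      hole = record { K = K ; 2≤K = s≤s (s≤s z≤n) ; c = c ; c∈W = λ i → proj₁ (step i)
                    ; period = period ; c⇒c = c⇒c ; chordless = chordless }

  -- The dichotomy: a hole or χ = ω

  HoleOrχ≡ω : Subset n → Set
  HoleOrχ≡ω W = Hole W ⊎ χ≡ω W

  module Cases (W : Subset n) (rec : ∀ {W′} → ∣ W′ ∣ < ∣ W ∣ → HoleOrχ≡ω W′) where

    open Within W

    without : ∀ {p} → p ∈ W → (χ≡ω (W - p) → χ≡ω W) → HoleOrχ≡ω W
    without {p} p∈W reduce with rec (x∈p⇒∣p-x∣<∣p∣ p∈W)
    ... | inj₁ hole = inj₁ (hole-mono (p-x⊆p W p) hole)
    ... | inj₂ P    = inj₂ (reduce P)

    -- By x → y, all out-neighbours of `v` are equal or adjacent to `y`, so `y` dominates `v` unless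
    -- v → y. In that case the triangle has the reversed arc y → x, as no arc enters `v`, and `v` is
    -- simplicial.
    source : ∀ {v x y} → v ∈ W → (∀ {u} → u ∈ W → ¬ u ⇒ v) → x ∈ W → y ∈ W → v ⇒ x → x ⇒ y → HoleOrχ≡ω W
    source {v} {x} {y} v∈W noIn x∈W y∈W v⇒x x⇒y with v ~? y
    ... | no v≁y = without v∈W (dominated y∈W (λ { refl → noIn x∈W x⇒y }) v≁y N⊆)
      where
      N⊆ : ∀ {z} → z ∈ W → z ~ v → z ~ y
      N⊆ z∈W (inj₁ z⇒v) = contradiction z⇒v (noIn z∈W)
      N⊆ z∈W (inj₂ v⇒z) = ≃⇒~ (λ { refl → v≁y (inj₁ v⇒z) }) (alos v⇒x v⇒z x⇒y)
    ... | yes (inj₂ y⇒v) = contradiction y⇒v (noIn y∈W)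
    ... | yes (inj₁ v⇒y) with nontransitive v⇒x x⇒y v⇒y
    ...   | inj₁ x⇒v        = contradiction x⇒v (noIn x∈W)
    ...   | inj₂ (inj₂ y⇒v) = contradiction y⇒v (noIn y∈W)
    ...   | inj₂ (inj₁ y⇒x) = without v∈W (simplicial v∈W N-clique)
      where
      near-x : ∀ {z} → v ⇒ z → z ≃ x
      near-x v⇒z = alos v⇒y v⇒z y⇒x
      N-clique : ∀ {z z′} → z ∈ W → z′ ∈ W → z ~ v → z′ ~ v → z ≃ z′
      N-clique z∈W z′∈W (inj₁ z⇒v) _          = contradiction z⇒v (noIn z∈W)
      N-clique z∈W z′∈W (inj₂ _)   (inj₁ z′⇒v) = contradiction z′⇒v (noIn z′∈W)
      N-clique {z} z∈W z′∈W (inj₂ v⇒z) (inj₂ v⇒z′) with near-x v⇒z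
      ... | inj₂ refl        = ≃-sym (near-x v⇒z′)
      ... | inj₁ (inj₂ x⇒z)  = ≃-sym (alos v⇒x v⇒z′ x⇒z)
      ... | inj₁ (inj₁ z⇒x) with nontransitive v⇒z z⇒x v⇒x
      ...   | inj₁ z⇒v        = contradiction z⇒v (noIn z∈W)
      ...   | inj₂ (inj₂ x⇒v) = contradiction x⇒v (noIn x∈W)
      ...   | inj₂ (inj₁ x⇒z) = ≃-sym (alos v⇒x v⇒z′ x⇒z)

    -- b and b′ are non-adjacent and every in-neighbour of b is adjacent to b′:
    -- the vertices adjacent to both, together with the out-neighbours of common
    -- in-neighbours, are closed under out-neighbours.
    diamond : ∀ {u b b′ w} → (∀ {x y} → x ∈ W → y ∈ W → Reach x y) →
              u ∈ W → b ∈ W → b′ ∈ W → w ∈ W →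
              u ⇒ b → u ⇒ b′ → b ⇒ w → b′ ⇒ w → w ⇒ u → b ≢ b′ → ¬ b ~ b′ → HoleOrχ≡ω W
    diamond {u} {b} {b′} {w} strong u∈W b∈W b′∈W w∈W u⇒b u⇒b′ b⇒w b′⇒w w⇒u b≢b′ b≁b′ =
      without b∈W (dominated b′∈W b≢b′ b≁b′ N⊆)
      where
      b≄b′ : ¬ b ≃ b′
      b≄b′ = [ b≁b′ , b≢b′ ]′
      Both Next′ : Fin n → Set
      Both v = v ~ b × v ~ b′
      Next′ v = ∃[ t ] (t ⇒ b × t ⇒ b′ × t ⇒ v)
      both : ∀ {v} → b ≃ v → b′ ≃ v → Both v
      both b≃v b′≃v = ~-sym (≃⇒~ (λ { refl → b≄b′ (≃-sym b′≃v) }) b≃v) ,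
                      ~-sym (≃⇒~ (λ { refl → b≄b′ b≃v }) b′≃v)
      after-next : ∀ {v v′} → Next′ v → v ⇒ v′ → Both v′
      after-next (t , t⇒b , t⇒b′ , t⇒v) v⇒v′ = both (alos t⇒v t⇒b v⇒v′) (alos t⇒v t⇒b′ v⇒v′)
      after-near-u : ∀ {v v′} → v ≃ u → v ⇒ v′ → Both v′ ⊎ Next′ v′
      after-near-u (inj₁ (inj₁ v⇒u)) v⇒v′ = inj₁ (both (≃-sym (alos v⇒u v⇒v′ u⇒b)) (≃-sym (alos v⇒u v⇒v′ u⇒b′)))
      after-near-u (inj₁ (inj₂ u⇒v)) v⇒v′ = inj₁ (both (alos u⇒v u⇒b v⇒v′) (alos u⇒v u⇒b′ v⇒v′))
      after-near-u (inj₂ refl)       v⇒v′ = inj₂ (u , u⇒b , u⇒b′ , v⇒v′)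
      after-both : ∀ {v v′} → Both v → v ⇒ v′ → Both v′ ⊎ Next′ v′
      after-both (inj₁ v⇒b , inj₁ v⇒b′) v⇒v′ = inj₂ (_ , v⇒b , v⇒b′ , v⇒v′)
      after-both (inj₂ b⇒v , _)         v⇒v′ = after-near-u (alos b⇒w b⇒v w⇒u) v⇒v′
      after-both (inj₁ _ , inj₂ b′⇒v)   v⇒v′ = after-near-u (alos b′⇒w b′⇒v w⇒u) v⇒v′
      sweep : ∀ {v v′} → Both v ⊎ Next′ v → Reach v v′ → Both v′ ⊎ Next′ v′
      sweep p        ε                     = p
      sweep (inj₁ p) ((_ , _ , v⇒) ◅ rest) = sweep (after-both p v⇒) rest
      sweep (inj₂ p) ((_ , _ , v⇒) ◅ rest) = sweep (inj₁ (after-next p v⇒)) rest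
      N⊆ : ∀ {z} → z ∈ W → z ~ b → z ~ b′
      N⊆ z∈W (inj₂ b⇒z) = ~-sym (≃⇒~ (λ { refl → b≁b′ (inj₁ b⇒z) }) (alos u⇒b u⇒b′ b⇒z))
      N⊆ z∈W (inj₁ z⇒b) with sweep (inj₁ (inj₁ u⇒b , inj₁ u⇒b′)) (strong u∈W z∈W)
      ... | inj₁ (_ , z~b′) = z~b′
      ... | inj₂ next       = contradiction (proj₁ (after-next next z⇒b)) ~-irrefl

    -- If all out-neighbours of the triangle are near its three vertices, nearness spreads along
    -- arcs, and strong connectivity makes `c₀` universal. Otherwise some a → y escapes; local
    -- out-semicompleteness then leaves only y → c with `y` and `b` unrelated, which is the
    -- configuration of `diamond`.
    triangle : ∀ {c₀ c₁ c₂} → (∀ {x y} → x ∈ W → y ∈ W → Reach x y) →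
               Step c₀ c₁ → Step c₁ c₂ → Step c₂ c₀ → HoleOrχ≡ω W
    triangle {c₀} {c₁} {c₂} strong s₀@(c₀∈W , c₁∈W , c₀⇒c₁) s₁@(_ , c₂∈W , c₁⇒c₂) s₂@(_ , _ , c₂⇒c₀) =
      decide (escape? c₀ c₁ c₂) (escape? c₁ c₂ c₀) (escape? c₂ c₀ c₁)
      where
      Near : Fin n → Set
      Near v = v ≃ c₀ × v ≃ c₁ × v ≃ c₂
      Escape : Fin n → Fin n → Fin n → Set
      Escape a b c = ∃[ y ] (y ∈ W × a ⇒ y × ¬ (y ≃ a × y ≃ b × y ≃ c))
      escape? : ∀ a b c → Dec (Escape a b c)
      escape? a b c = any? λ y → (y ∈? W) ×-dec (a ⇒? y) ×-dec ¬? ((y ≃? a) ×-dec (y ≃? b) ×-dec (y ≃? c))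
      escaped : ∀ {a b c} → Step a b → Step b c → Step c a → Escape a b c → HoleOrχ≡ω W
      escaped {a} {b} {c} (a∈W , b∈W , a⇒b) (_ , c∈W , b⇒c) (_ , _ , c⇒a) (y , y∈W , a⇒y , far)
        with alos a⇒b a⇒y b⇒c
      ... | inj₂ refl       = ⊥-elim (far (inj₁ (inj₂ a⇒y) , inj₁ (inj₂ b⇒c) , inj₂ refl))
      ... | inj₁ (inj₂ c⇒y) = ⊥-elim (far (inj₁ (inj₂ a⇒y) , alos c⇒a c⇒y a⇒b , inj₁ (inj₂ c⇒y)))
      ... | inj₁ (inj₁ y⇒c) = diamond strong a∈W b∈W y∈W c∈W a⇒b a⇒y b⇒c y⇒c c⇒a
        (λ { refl → near (inj₂ refl) }) (near ∘ inj₁ ∘ ~-sym)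
        where
        near : ¬ y ≃ b
        near y≃b = far (inj₁ (inj₂ a⇒y) , y≃b , inj₁ (inj₁ y⇒c))
      decide : Dec (Escape c₀ c₁ c₂) → Dec (Escape c₁ c₂ c₀) → Dec (Escape c₂ c₀ c₁) → HoleOrχ≡ω W
      decide (yes esc) _ _ = escaped s₀ s₁ s₂ esc
      decide _ (yes esc) _ = escaped s₁ s₂ s₀ esc
      decide _ _ (yes esc) = escaped s₂ s₀ s₁ esc
      decide (no none₀) (no none₁) (no none₂) =
        without c₀∈W (universal c₀∈W λ v∈W → proj₁ (sweep (strong c₀∈W v∈W)
          (inj₂ refl , inj₁ (inj₁ c₀⇒c₁) , inj₁ (inj₂ c₂⇒c₀))))
        where
        near₀ : ∀ {y} → y ∈ W → c₀ ⇒ y → Near y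
        near₀ {y} y∈W ⇒y = decidable-stable ((y ≃? c₀) ×-dec (y ≃? c₁) ×-dec (y ≃? c₂))
          λ far → none₀ (y , y∈W , ⇒y , far)
        near₁ : ∀ {y} → y ∈ W → c₁ ⇒ y → Near y
        near₁ {y} y∈W ⇒y with decidable-stable ((y ≃? c₁) ×-dec (y ≃? c₂) ×-dec (y ≃? c₀))
          (λ far → none₁ (y , y∈W , ⇒y , far))
        ... | p , q , r = r , p , q
        near₂ : ∀ {y} → y ∈ W → c₂ ⇒ y → Near y
        near₂ {y} y∈W ⇒y with decidable-stable ((y ≃? c₂) ×-dec (y ≃? c₀) ×-dec (y ≃? c₁))
          (λ far → none₂ (y , y∈W , ⇒y , far))
        ... | p , q , r = q , r , p
        shift : ∀ {v v′ a b} → v ~ a → a ⇒ b → v ⇒ v′ → v′ ≃ b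
        shift (inj₁ v⇒a) a⇒b v⇒v′ = alos v⇒a v⇒v′ a⇒b
        shift (inj₂ a⇒v) a⇒b v⇒v′ = ≃-sym (alos a⇒v a⇒b v⇒v′)
        near-step : ∀ {v v′} → v′ ∈ W → Near v → v ⇒ v′ → Near v′
        near-step v′∈W (inj₂ refl , _ , _) v⇒v′ = near₀ v′∈W v⇒v′
        near-step v′∈W (_ , inj₂ refl , _) v⇒v′ = near₁ v′∈W v⇒v′
        near-step v′∈W (_ , _ , inj₂ refl) v⇒v′ = near₂ v′∈W v⇒v′
        near-step v′∈W (inj₁ v~c₀ , inj₁ v~c₁ , inj₁ v~c₂) v⇒v′ =
          shift v~c₂ c₂⇒c₀ v⇒v′ , shift v~c₀ c₀⇒c₁ v⇒v′ , shift v~c₁ c₁⇒c₂ v⇒v′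
        sweep : ∀ {v v′} → Reach v v′ → Near v → Near v′
        sweep ε near = near
        sweep ((_ , v∈W , v⇒) ◅ rest) near = sweep rest (near-step v∈W near v⇒)

    Step² : Fin n → Fin n → Set
    Step² u w = ∃[ v ] (Step u v × Step v w)

    Even Odd : Fin n → Fin n → Set
    Even = Star Step²
    Odd u w = ∃[ v ] (Even u v × Step v w)

    even? : ∀ u v → Dec (Even u v)
    even? = star? λ u w → any? λ v → step? u v ×-dec step? v w

    odd? : ∀ u w → Dec (Odd u w)
    odd? u w = any? λ v → even? u v ×-dec step? v w

    even⇒walk : ∀ {u v} → Even u v → ∃[ k ] Walk (k + k) u v
    even⇒walk ε = 0 , []
    even⇒walk {v = v} ((m , s , t) ◅ rest) with even⇒walk rest
    ... | k , ws = suc k , s ∷ subst (λ j → Walk j m v) (sym (ℕ.+-suc k k)) (t ∷ ws)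

    parity : ∀ {u v w} → Even u v → Reach v w → Even u w ⊎ Odd u w
    parity e ε = inj₁ e
    parity e (s ◅ ε) = inj₂ (_ , e , s)
    parity e (s ◅ t ◅ rest) = parity (e ◅◅ ((_ , s , t) ◅ ε)) rest

    -- If no vertex is reached from `x` in both parities, parity is a 2-colouring. Otherwise one of
    -- the two walks to such a vertex forms an odd closed walk with the way back, and a shortest one
    -- is a triangle or a hole.
    stronglyConnected : ∀ {x} → x ∈ W → (∀ {u v} → u ∈ W → v ∈ W → Reach u v) → HoleOrχ≡ω W
    stronglyConnected {x} x∈W strong with any? (λ v → even? x v ×-dec odd? x v)
    ... | no disjoint = inj₂ (bipartite (even? x)
      (λ {u} {v} u∈W v∈W u⇒v u-even v-even → disjoint (v , v-even , u , u-even , u∈W , v∈W , u⇒v)) odd⇒even)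
      where
      odd⇒even : ∀ {u v} → u ∈ W → v ∈ W → u ⇒ v → ¬ Even x u → ¬ ¬ Even x v
      odd⇒even {u} u∈W v∈W u⇒v u-odd v-odd with parity ε (strong x∈W u∈W)
      ... | inj₁ u-even           = u-odd u-even
      ... | inj₂ (_ , t-even , s) = v-odd (t-even ◅◅ ((u , s , u∈W , v∈W , u⇒v) ◅ ε))
    ... | yes (v , v-even , r , r-even , s@(_ , v∈W , _)) = go (least closed? {proj₁ oddClosed} (proj₂ oddClosed))
      where
      closed? : Decidable (λ k → ∃[ y ] Walk (suc (k + k)) y y)
      closed? k = any? λ y → walk? (suc (k + k)) y y
      oddClosed : ∃[ k ] ∃[ y ] Walk (suc (k + k)) y y
      oddClosed with reach⇒walk (strong v∈W x∈W) | even⇒walk v-even | even⇒walk r-even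
      ... | m , home | j , v-walk | k , r-walk with halve m
      ...   | e , inj₁ refl = k + e , x , subst (λ i → Walk i x x) (eq k e) (r-walk ++ʷ (s ∷ home))
        where
        eq : ∀ k e → k + k + suc (e + e) ≡ suc ((k + e) + (k + e))
        eq = solve-∀
      ...   | e , inj₂ refl = j + e , x , subst (λ i → Walk i x x) (eq j e) (v-walk ++ʷ home)
        where
        eq : ∀ k e → k + k + suc (e + e) ≡ suc ((k + e) + (k + e))
        eq = solve-∀
      go : ∃[ K ] ((∃[ y ] Walk (suc (K + K)) y y) × (∀ {k} → ∃[ y ] Walk (suc (k + k)) y y → K ≤ k)) → HoleOrχ≡ω W
      go (0 , (y , (_ , _ , y⇒y) ∷ []) , _)   = contradiction y⇒y (loopless D y)
      go (1 , (y , s₀ ∷ s₁ ∷ s₂ ∷ []) , _)    = triangle strong s₀ s₁ s₂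
      go (suc (suc q) , (y , walk) , shortest) = inj₁ (Shortest.hole {q} walk shortest)

    -- As `v₀` is initial, its ancestors `C` form its strong component, and no arc of `W` enters
    -- `C`. The arc from `u₀` ensures that every vertex of `C` has an out-neighbour in `C`.
    module Component {v₀ u₀} (v₀∈W : v₀ ∈ W) (initial : Initial v₀) (u₀⇒v₀ : Step u₀ v₀) where

      C : Fin n → Set
      C v = Reach v v₀

      C? : Decidable C
      C? v = reach? v v₀

      C⇒W : ∀ {v} → C v → v ∈ W
      C⇒W ε                 = v₀∈W
      C⇒W ((v∈W , _) ◅ _) = v∈W

      strong : ∀ {u v} → C u → C v → Reach u v
      strong u∈C v∈C = u∈C ◅◅ initial _ v∈C

      C-closed : ∀ {u v} → u ∈ W → u ⇒ v → C v → C u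
      C-closed u∈W u⇒v v∈C = (u∈W , C⇒W v∈C , u⇒v) ◅ v∈C

      successor : ∀ {c} → C c → ∃[ c′ ] (C c′ × c ⇒ c′)
      successor ((_ , _ , c⇒c′) ◅ rest) = _ , rest , c⇒c′
      successor ε with initial u₀ (u₀⇒v₀ ◅ ε)
      ... | ε                        = contradiction (proj₂ (proj₂ u₀⇒v₀)) (loopless D _)
      ... | (_ , _ , c⇒c′) ◅ rest = _ , rest ◅◅ (u₀⇒v₀ ◅ ε) , c⇒c′

      module _ {y} (y∈W : y ∈ W) (y∉C : ¬ C y) where

        -- Local out-semicompleteness relates `y` and `c″`, and no arc enters `C`. So arcs to `y`
        -- recur at every second vertex of a walk in `C`.
        propagate : ∀ {c c′ c″} → c ⇒ y → c ⇒ c′ → c′ ⇒ c″ → C c″ → c″ ⇒ y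
        propagate c⇒y c⇒c′ c′⇒c″ c″∈C with alos c⇒c′ c⇒y c′⇒c″
        ... | inj₁ (inj₁ y⇒c″) = contradiction (C-closed y∈W y⇒c″ c″∈C) y∉C
        ... | inj₁ (inj₂ c″⇒y) = c″⇒y
        ... | inj₂ refl         = contradiction c″∈C y∉C

        NowOrNext : Fin n → Set
        NowOrNext d = d ⇒ y ⊎ (∀ {d′} → C d′ → d ⇒ d′ → d′ ⇒ y)

        alternate : ∀ {c d} → NowOrNext c → Reach c d → C d → NowOrNext d
        alternate p ε _ = p
        alternate (inj₁ c⇒y)  ((_ , _ , c⇒c′) ◅ rest) d∈C =
          alternate (inj₂ λ c″∈C c′⇒c″ → propagate c⇒y c⇒c′ c′⇒c″ c″∈C) rest d∈C
        alternate (inj₂ next) ((_ , _ , c⇒c′) ◅ rest) d∈C =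
          alternate (inj₁ (next (rest ◅◅ d∈C) c⇒c′)) rest d∈C

        -- `y` dominates `a`: an in-neighbour of `a` lies in `C` and sends an arc to `y` by
        -- `alternate`, since its out-neighbour `a` does not. Out-neighbours of `a` are compared
        -- with `y` through a → b → y with `b` in `C`.
        exitDominates : ∀ {c a} → C c → C a → c ⇒ y → c ⇒ a → ¬ a ⇒ y → HoleOrχ≡ω W
        exitDominates {c} {a} c∈C a∈C c⇒y c⇒a a⇏y =
          without (C⇒W a∈C) (dominated y∈W (λ { refl → y∉C a∈C })
            [ a⇏y , (λ y⇒a → y∉C (C-closed y∈W y⇒a a∈C)) ]′ N⊆)
          where
          N⊆ : ∀ {z} → z ∈ W → z ~ a → z ~ y
          N⊆ {z} z∈W (inj₁ z⇒a) with alternate (inj₁ c⇒y) (strong c∈C (C-closed z∈W z⇒a a∈C)) (C-closed z∈W z⇒a a∈C)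
          ... | inj₁ z⇒y  = inj₁ z⇒y
          ... | inj₂ next = contradiction (next a∈C z⇒a) a⇏y
          N⊆ {z} z∈W (inj₂ a⇒z) with successor a∈C
          ... | b , b∈C , a⇒b = ≃⇒~ (λ { refl → a⇏y a⇒z }) (alos a⇒b a⇒z (propagate c⇒y c⇒a a⇒b b∈C))

        swept : (∀ {c a} → C c → C a → c ⇒ y → c ⇒ a → a ⇒ y) → ∀ {c d} → C c → C d → c ⇒ y → d ⇒ y
        swept total c∈C d∈C c⇒y = go (strong c∈C d∈C) d∈C c⇒y
          where
          go : ∀ {c d} → Reach c d → C d → c ⇒ y → d ⇒ y
          go ε _ c⇒y = c⇒y
          go ((c∈W , _ , c⇒c′) ◅ rest) d∈C c⇒y =
            go rest d∈C (total (C-closed c∈W c⇒c′ (rest ◅◅ d∈C)) (rest ◅◅ d∈C) c⇒y c⇒c′)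

      Exit : Fin n → Fin n → Set
      Exit c y = C c × y ∈ W × ¬ C y × c ⇒ y

      exit? : ∀ c y → Dec (Exit c y)
      exit? c y = C? c ×-dec (y ∈? W) ×-dec ¬? (C? y) ×-dec (c ⇒? y)

      -- Here every exit y has all of C as in-neighbours, so C is symmetric
      -- (no transitive triangles) and its exits form a clique.
      completeExit : ∀ {a y} → Exit a y →
                     (∀ {y c d} → y ∈ W → ¬ C y → C c → C d → c ⇒ y → d ⇒ y) → HoleOrχ≡ω W
      completeExit {a} {y} (a∈C , y∈W , y∉C , a⇒y) total
        with any? (λ z → any? λ z′ → (z ∈? W) ×-dec (z′ ∈? W) ×-dec (z ~? a) ×-dec (z′ ~? a) ×-dec ¬? (z ≃? z′))
      ... | no none = without (C⇒W a∈C) (simplicial (C⇒W a∈C) λ {z} {z′} z∈W z′∈W z~a z′~a →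
              decidable-stable (z ≃? z′) λ z≄z′ → none (z , z′ , z∈W , z′∈W , z~a , z′~a , z≄z′))
      ... | yes (z , z′ , z∈W , z′∈W , z~a , z′~a , z≄z′) = split (C? z) (C? z′)
        where
        symmetric : ∀ {c d} → C c → C d → c ⇒ d → d ⇒ c
        symmetric {c} {d} c∈C d∈C c⇒d
          with nontransitive c⇒d (total y∈W y∉C a∈C d∈C a⇒y) (total y∈W y∉C a∈C c∈C a⇒y)
        ... | inj₁ d⇒c        = d⇒c
        ... | inj₂ (inj₁ y⇒d) = contradiction (C-closed y∈W y⇒d d∈C) y∉C
        ... | inj₂ (inj₂ y⇒c) = contradiction (C-closed y∈W y⇒c c∈C) y∉C
        out : ∀ {c z} → C c → z ∈ W → z ~ c → C z → c ⇒ z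
        out c∈C z∈W (inj₁ z⇒c) z∈C = symmetric z∈C c∈C z⇒c
        out c∈C z∈W (inj₂ c⇒z) z∈C = c⇒z
        exits : ∀ {c z} → C c → z ∈ W → z ~ c → ¬ C z → c ⇒ z
        exits c∈C z∈W (inj₁ z⇒c) z∉C = contradiction (C-closed z∈W z⇒c c∈C) z∉C
        exits c∈C z∈W (inj₂ c⇒z) z∉C = c⇒z
        split : Dec (C z) → Dec (C z′) → HoleOrχ≡ω W
        split (no z∉C) (no z′∉C) with successor a∈C
        ... | b , b∈C , a⇒b = contradiction
          (alos a⇒b (exits a∈C z∈W z~a z∉C) (total z′∈W z′∉C a∈C b∈C (exits a∈C z′∈W z′~a z′∉C))) z≄z′
        split (yes z∈C) (no z′∉C) =
          contradiction (inj₁ (inj₁ (total z′∈W z′∉C a∈C z∈C (exits a∈C z′∈W z′~a z′∉C)))) z≄z′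
        split (no z∉C) (yes z′∈C) =
          contradiction (inj₁ (inj₂ (total z∈W z∉C a∈C z′∈C (exits a∈C z∈W z~a z∉C)))) z≄z′
        -- Two non-adjacent neighbours of `a` in `C`: from z → a, z → t and a → z′, every neighbour
        -- t of `z` in `C` is adjacent to `z′`.
        split (yes z∈C) (yes z′∈C) =
          without z∈W (dominated z′∈W (z≄z′ ∘ inj₂) (z≄z′ ∘ inj₁) N⊆)
          where
          N⊆ : ∀ {t} → t ∈ W → t ~ z → t ~ z′
          N⊆ {t} t∈W t~z with C? t
          ... | no t∉C = inj₂ (total t∈W t∉C z∈C z′∈C (exits z∈C t∈W t~z t∉C))
          ... | yes t∈C = ≃⇒~ (λ { refl → z≄z′ (inj₁ (~-sym t~z)) })
                  (alos (symmetric a∈C z∈C (out a∈C z∈W z~a z∈C)) (out z∈C t∈W t~z t∈C) (out a∈C z′∈W z′~a z′∈C))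

      -- Without exits no arc enters or leaves `C`, so `C` is all of `W` or can be coloured
      -- separately from the rest.
      component : HoleOrχ≡ω W
      component with any? (λ c → any? λ y → exit? c y)
      ... | yes (c , y , exit) with any? (λ c → any? λ y → any? λ a → exit? c y ×-dec C? a ×-dec (c ⇒? a) ×-dec ¬? (a ⇒? y))
      ...   | yes (c , y , a , (c∈C , y∈W , y∉C , c⇒y) , a∈C , c⇒a , a⇏y) = exitDominates y∈W y∉C c∈C a∈C c⇒y c⇒a a⇏y
      ...   | no none = completeExit exit λ {y} y∈W y∉C → swept y∈W y∉C λ {c} {a} c∈C a∈C c⇒y c⇒a →
        decidable-stable (a ⇒? y) λ a⇏y → none (c , y , a , (c∈C , y∈W , y∉C , c⇒y) , a∈C , c⇒a , a⇏y)
      component | no noExit with any? (λ w → (w ∈? W) ×-dec ¬? (C? w))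
      ... | no all∈C = stronglyConnected v₀∈W λ u∈W v∈W → strong (in-C u∈W) (in-C v∈W)
        where
        in-C : ∀ {v} → v ∈ W → C v
        in-C {v} v∈W = decidable-stable (C? v) λ v∉C → all∈C (v , v∈W , v∉C)
      ... | yes (w , w∈W , w∉C) with rec {sift C?} smaller | rec {W ─ sift C?} smaller′
        where
        smaller : ∣ sift C? ∣ < ∣ W ∣
        smaller = p⊂q⇒∣p∣<∣q∣ (C⇒W ∘ ∈-sift⁻ C? , w , w∈W , w∉C ∘ ∈-sift⁻ C?)
        smaller′ : ∣ W ─ sift C? ∣ < ∣ W ∣
        smaller′ = p∩q≢∅⇒∣p─q∣<∣p∣ W (sift C?) (v₀ , x∈p∩q⁺ (v₀∈W , ∈-sift⁺ C? ε))
      ...   | inj₁ hole | _         = inj₁ (hole-mono (C⇒W ∘ ∈-sift⁻ C?) hole)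
      ...   | inj₂ _    | inj₁ hole = inj₁ (hole-mono (p─q⊆p W (sift C?)) hole)
      ...   | inj₂ P    | inj₂ Q    = inj₂ (union closed (C⇒W ∘ ∈-sift⁻ C?) P Q)
        where
        closed : ∀ {u v} → u ∈ sift C? → v ∈ W → u ~ v → v ∈ sift C?
        closed u∈ v∈W (inj₂ v⇒u) = ∈-sift⁺ C? (C-closed v∈W v⇒u (∈-sift⁻ C? u∈))
        closed {u} {v} u∈ v∈W (inj₁ u⇒v) = ∈-sift⁺ C? (decidable-stable (C? v) λ v∉C →
          noExit (u , v , ∈-sift⁻ C? u∈ , v∈W , v∉C , u⇒v))

    HasIn : Fin n → Set
    HasIn v = ∃[ u ] Step u v

    hasIn? : Decidable HasIn
    hasIn? v = any? λ u → step? u v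

    -- If no initial vertex has an in-arc, every walk can be traced back to a source. Then either
    -- some source starts a walk of two arcs, or no such walk exists at all and having an in-arc is
    -- a 2-colouring.
    cases : HoleOrχ≡ω W
    cases with any? (λ v → (v ∈? W) ×-dec initial? v ×-dec hasIn? v)
    ... | yes (v , v∈W , init , u , s) = Component.component v∈W init s
    ... | no noInitial with any? (λ v → (v ∈? W) ×-dec ¬? (hasIn? v) ×-dec any? λ x → any? λ y → step? v x ×-dec step? x y)
    ...   | yes (v , v∈W , noIn , x , y , (_ , x∈W , v⇒x) , (_ , y∈W , x⇒y)) =
            source v∈W (λ u∈W u⇒v → noIn (_ , u∈W , v∈W , u⇒v)) x∈W y∈W v⇒x x⇒y
    ...   | no noPath = inj₂ (bipartite hasIn?
      (λ u∈W v∈W u⇒v in-u _ → no² in-u (u∈W , v∈W , u⇒v))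
      (λ {u} u∈W v∈W u⇒v _ ¬in-v → ¬in-v (u , u∈W , v∈W , u⇒v)))
      where
      start∈W : ∀ {u v} → v ∈ W → Reach u v → u ∈ W
      start∈W v∈W ε                 = v∈W
      start∈W v∈W ((u∈W , _) ◅ _) = u∈W
      no² : ∀ {u v} → HasIn u → ¬ Step u v
      no² {u} {v} in-u s@(u∈W , _) with initialAncestor u (<-wellFounded _)
      ... | p , p↝u , init with hasIn? p
      ...   | yes in-p = noInitial (p , start∈W u∈W p↝u , init , in-p)
      ...   | no ¬in-p with p↝u
      ...     | ε                = ¬in-p in-u
      ...     | t ◅ ε            = noPath (p , proj₁ t , ¬in-p , _ , _ , t , s)
      ...     | t ◅ t′ ◅ _       = noPath (p , proj₁ t , ¬in-p , _ , _ , t , t′)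

  holeOrχ≡ω : ∀ W → Acc _<_ ∣ W ∣ → HoleOrχ≡ω W
  holeOrχ≡ω W (acc rec) = Cases.cases W λ {W′} lt → holeOrχ≡ω W′ (rec lt)

  -- The classes around a hole

  module HoleFacts {W : Subset n} (H : Hole W) where

    open Hole H

    5≤L : 5 ≤ L
    5≤L = s≤s (ℕ.+-mono-≤ 2≤K 2≤K)

    ≤L : ∀ {d} → d ≤ 5 → d ≤ L
    ≤L d≤5 = ℕ.≤-trans d≤5 5≤L

    wrap : ∀ m d i → m + d ≡ L → c (m + (d + i)) ≡ c i
    wrap m d i eq = trans (cong c (trans (sym (ℕ.+-assoc m d i)) (cong (_+ i) eq))) (period i)

    noBackArc : ∀ i d → 1 ≤ d → 2 + d ≤ L → ¬ c (d + i) ⇒ c i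
    noBackArc i d 1≤d 2+d≤L back = chordless (d + i) (L ∸ d)
      (ℕ.m+n≤o⇒m≤o∸n 2 2+d≤L) (ℕ.∸-monoʳ-< {o = 0} 1≤d (ℕ.≤-trans (ℕ.m≤n+m d 2) 2+d≤L))
      (subst (c (d + i) ⇒_) (sym (wrap (L ∸ d) d i (ℕ.m∸n+n≡m (ℕ.≤-trans (ℕ.m≤n+m d 2) 2+d≤L)))) back)

    apart : ∀ i d → 2 ≤ d → 2 + d ≤ L → ¬ c i ≃ c (d + i)
    apart i d 2≤d 2+d≤L (inj₁ (inj₁ arc)) = chordless i d 2≤d (ℕ.≤-trans (ℕ.n≤1+n _) 2+d≤L) arc
    apart i d 2≤d 2+d≤L (inj₁ (inj₂ arc)) = noBackArc i d (ℕ.≤-trans (s≤s z≤n) 2≤d) 2+d≤L arc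
    apart i d 2≤d 2+d≤L (inj₂ eq) =
      chordless i (suc d) (ℕ.m≤n⇒m≤1+n 2≤d) 2+d≤L (subst (_⇒ c (suc d + i)) (sym eq) (c⇒c (d + i)))

    -- Two targets make one of them adjacent or equal to the successor of the other. Which one is
    -- shifted depends on `d`, so that the distance stays between 2 and L - 2, where `apart`
    -- applies.
    oneTarget : ∀ {v} i d → 1 ≤ d → d < L → v ⇒ c i → ¬ v ⇒ c (d + i)
    oneTarget i 1 _ d<L v⇒ v⇒′ = apart i 2 (s≤s (s≤s z≤n)) (≤L (ℕ.n≤1+n 4)) (alos v⇒′ v⇒ (c⇒c (1 + i)))
    oneTarget i 2 _ d<L v⇒ v⇒′ = apart i 3 (s≤s (s≤s z≤n)) 5≤L (alos v⇒′ v⇒ (c⇒c (2 + i)))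
    oneTarget i (suc (suc (suc e))) _ d<L v⇒ v⇒′ = apart (1 + i) (2 + e) (s≤s (s≤s z≤n)) d<L
      (subst (λ j → c (1 + i) ≃ c j) (sym (ℕ.+-suc (2 + e) i)) (≃-sym (alos v⇒ v⇒′ (c⇒c i))))

    -- If the arc went from `c (2 + i)` to `y` instead, arcs to `y` would recur around the hole in
    -- steps of two. As L is odd they arrive at `c (1 + i)`, and `c i`, `c (1 + i)`, `y` form a
    -- triangle none of whose arcs can be reversed.
    successor : ∀ {y} i → c i ⇒ y → y ⇒ c (2 + i)
    successor {y} i i⇒y with alos (c⇒c i) i⇒y (c⇒c (1 + i))
    ... | inj₂ refl          = contradiction i⇒y (chordless i 2 ℕ.≤-refl (≤L (s≤s (s≤s (s≤s z≤n)))))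
    ... | inj₁ (inj₁ y⇒2+i) = y⇒2+i
    ... | inj₁ (inj₂ 2+i⇒y) = ⊥-elim impossible
      where
      not-y⇒1+i : ¬ y ⇒ c (1 + i)
      not-y⇒1+i y⇒ = apart (1 + i) 2 ℕ.≤-refl (≤L (ℕ.n≤1+n 4)) (≃-sym (alos 2+i⇒y (c⇒c (2 + i)) y⇒))
      not-y⇒i : ¬ y ⇒ c i
      not-y⇒i y⇒ = apart i 3 (s≤s (s≤s z≤n)) 5≤L (≃-sym (alos 2+i⇒y (c⇒c (2 + i)) y⇒))
      blocked : ∀ e → e < K → ¬ y ⇒ c ((suc e + suc e) + (2 + i))
      blocked e e<K y⇒ with ℕ.m≤n⇒m<n∨m≡n e<K
      ... | inj₂ refl = not-y⇒1+i (subst (y ⇒_) (trans (cong c (eq e i)) (period (1 + i))) y⇒)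
        where
        eq : ∀ e i → (suc e + suc e) + (2 + i) ≡ suc (suc e + suc e) + (1 + i)
        eq = solve-∀
      ... | inj₁ 1+e<K = apart (1 + i) (suc (suc e + suc e)) (s≤s (s≤s z≤n))
        (s≤s (subst (_≤ K + K) (cong suc (ℕ.+-suc (suc e) (suc e))) (ℕ.+-mono-≤ 1+e<K 1+e<K)))
        (alos i⇒y (c⇒c i) (subst (λ j → y ⇒ c j) (eq e i) y⇒))
        where
        eq : ∀ e i → (suc e + suc e) + (2 + i) ≡ suc (suc e + suc e) + (1 + i)
        eq = solve-∀
      every : ∀ e → e ≤ K → c ((e + e) + (2 + i)) ⇒ y
      every zero    _   = 2+i⇒y
      every (suc e) e<K with every e (ℕ.<⇒≤ e<K)
      ... | e⇒y with alos (c⇒c ((e + e) + (2 + i))) e⇒y (c⇒c (suc ((e + e) + (2 + i))))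
      ...   | inj₂ refl      = contradiction e⇒y (chordless _ 2 ℕ.≤-refl (≤L (s≤s (s≤s (s≤s z≤n)))))
      ...   | inj₁ (inj₂ arc) = subst (λ j → c (j + (2 + i)) ⇒ y) (cong suc (sym (ℕ.+-suc e e))) arc
      ...   | inj₁ (inj₁ arc) = contradiction
        (subst (λ j → y ⇒ c (j + (2 + i))) (cong suc (sym (ℕ.+-suc e e))) arc) (blocked e e<K)
      impossible : Data.Empty.⊥
      impossible with nontransitive (c⇒c i) 1+i⇒y i⇒y
        where
        eq : ∀ K i → (K + K) + (2 + i) ≡ suc (K + K) + (1 + i)
        eq = solve-∀
        1+i⇒y : c (1 + i) ⇒ y
        1+i⇒y = subst (_⇒ y) (trans (cong c (eq K i)) (period (1 + i))) (every K ℕ.≤-refl)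
      ... | inj₁ back      = noBackArc i 1 (s≤s z≤n) (≤L (s≤s (s≤s (s≤s z≤n)))) back
      ... | inj₂ (inj₁ y⇒) = not-y⇒1+i y⇒
      ... | inj₂ (inj₂ y⇒) = not-y⇒i y⇒

    -- With `twin⁺`: each out-neighbour of `c i` has exactly the out-neighbours of `c (1 + i)`. In
    -- both proofs the other alternatives are followed along the hole until a chord appears or a
    -- vertex has two targets on the hole.
    twin⁻ : ∀ {y z} i → c i ⇒ y → y ⇒ z → c (1 + i) ⇒ z
    twin⁻ i i⇒y y⇒z with alos i⇒y (c⇒c i) y⇒z | successor i i⇒y
    ... | inj₁ (inj₁ 1+i⇒z) | _      = 1+i⇒z
    ... | inj₂ refl          | y⇒2+i = contradiction y⇒2+i (oneTarget (1 + i) 1 ℕ.≤-refl (≤L (s≤s (s≤s z≤n))) y⇒z)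
    ... | inj₁ (inj₂ z⇒1+i) | y⇒2+i with alos y⇒2+i y⇒z (c⇒c (2 + i))
    ...   | inj₂ refl          = contradiction y⇒z (oneTarget (2 + i) 1 ℕ.≤-refl (≤L (s≤s (s≤s z≤n))) y⇒2+i)
    ...   | inj₁ (inj₁ z⇒3+i) = contradiction z⇒3+i (oneTarget (1 + i) 2 (s≤s z≤n) (≤L (s≤s (s≤s (s≤s z≤n)))) z⇒1+i)
    ...   | inj₁ (inj₂ 3+i⇒z) = contradiction (successor (3 + i) 3+i⇒z) (oneTarget (1 + i) 4 (s≤s z≤n) 5≤L z⇒1+i)

    twin⁺ : ∀ {y z} i → c i ⇒ y → c (1 + i) ⇒ z → y ⇒ z
    twin⁺ i i⇒y 1+i⇒z with alos (c⇒c i) i⇒y 1+i⇒z | successor i i⇒y | successor (1 + i) 1+i⇒z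
    ... | inj₁ (inj₁ y⇒z) | _ | _ = y⇒z
    ... | inj₂ refl | y⇒2+i | y⇒3+i = contradiction y⇒3+i (oneTarget (2 + i) 1 ℕ.≤-refl (≤L (s≤s (s≤s z≤n))) y⇒2+i)
    ... | inj₁ (inj₂ z⇒y) | y⇒2+i | z⇒3+i with alos z⇒3+i z⇒y (c⇒c (3 + i))
    ...   | inj₂ refl          = contradiction i⇒y (chordless i 4 (s≤s (s≤s z≤n)) 5≤L)
    ...   | inj₁ (inj₁ y⇒4+i) = contradiction y⇒4+i (oneTarget (2 + i) 2 (s≤s z≤n) (≤L (s≤s (s≤s (s≤s z≤n)))) y⇒2+i)
    ...   | inj₁ (inj₂ 4+i⇒y) = contradiction (successor (4 + i) 4+i⇒y) (oneTarget (2 + i) 4 (s≤s z≤n) 5≤L y⇒2+i)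

    turns : ∀ q i → c (q * L + i) ≡ c i
    turns zero    i = refl
    turns (suc q) i = trans (cong c (ℕ.+-assoc L (q * L) i)) (trans (period (q * L + i)) (turns q i))

    reduce : ∀ i → c (i % L) ≡ c i
    reduce i = sym (trans (cong c (trans (m≡m%n+[m/n]*n i L) (ℕ.+-comm (i % L) _))) (turns (i / L) (i % L)))

    -- The union of the classes; it contains the hole, as `c i` is a successor of its predecessor.
    Core : Fin n → Set
    Core v = ∃[ i ] c i ⇒ v

    core? : Decidable Core
    core? v = map′ (λ (i , _ , i⇒v) → i , i⇒v)
                   (λ (i , i⇒v) → i % L , m%n<n i L , subst (_⇒ v) (sym (reduce i)) i⇒v)
                   (anyUpTo? (λ i → c i ⇒? v) L)

    core-c : ∀ i → Core (c i)
    core-c i = K + K + i , subst (c (K + K + i) ⇒_) (period i) (c⇒c (K + K + i))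

    core-closed : ∀ {v w} → Core v → v ⇒ w → Core w
    core-closed (i , i⇒v) v⇒w = 1 + i , twin⁻ i i⇒v v⇒w

    open Within W public

    ReachesCore : Fin n → Set
    ReachesCore v = ∃[ t ] (Core t × Reach v t)

    reachesCore? : Decidable ReachesCore
    reachesCore? v = any? λ t → core? t ×-dec reach? v t

    -- Compare `z` with the vertex two steps ahead on the walk to the core: `z` joins the walk
    -- there, or is an out-neighbour of that vertex and the argument moves two steps on.
    reachesCore-out : ∀ {v z} → ReachesCore v → z ∈ W → v ⇒ z → ReachesCore z
    reachesCore-out (t , core@(i , i⇒t) , v↝t) = go v↝t
      where
      go : ∀ {v z} → Reach v t → z ∈ W → v ⇒ z → ReachesCore z
      go ε z∈W v⇒z = _ , core-closed core v⇒z , ε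
      go ((_ , t∈W , v⇒t) ◅ ε) z∈W v⇒z with alos v⇒t v⇒z (successor i i⇒t)
      ... | inj₁ (inj₁ z⇒2+i) = _ , core-c (2 + i) , (z∈W , c∈W (2 + i) , z⇒2+i) ◅ ε
      ... | inj₁ (inj₂ 2+i⇒z) = _ , (2 + i , 2+i⇒z) , ε
      ... | inj₂ refl          = _ , core-c (2 + i) , ε
      go ((_ , _ , v⇒v₁) ◅ (_ , v₂∈W , v₁⇒v₂) ◅ rest) z∈W v⇒z with alos v⇒v₁ v⇒z v₁⇒v₂
      ... | inj₁ (inj₁ z⇒v₂) = t , core , (z∈W , v₂∈W , z⇒v₂) ◅ rest
      ... | inj₁ (inj₂ v₂⇒z) = go rest z∈W v₂⇒z
      ... | inj₂ refl         = t , core , rest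

    InTriangle : Fin n → Set
    InTriangle v = ∃[ a ] ∃[ b ] (v ~ a × v ~ b × a ~ b)

    -- Makes triangles travel along arcs, as `v`, `v′`, `y` form a triangle again. Hence a triangle
    -- at a vertex that reaches the core could be moved into the core.
    triangle-shift : ∀ {v v′} → InTriangle v → v ⇒ v′ → ∃[ y ] (y ~ v × y ~ v′)
    triangle-shift (a , b , v~a , v~b , inj₁ a⇒b) v⇒v′ = shift v~a v~b a⇒b v⇒v′
      where
      shift : ∀ {v v′ a b} → v ~ a → v ~ b → a ⇒ b → v ⇒ v′ → ∃[ y ] (y ~ v × y ~ v′)
      shift {v} {v′} {a} {b} v~a v~b a⇒b v⇒v′ with v~a
      ... | inj₁ v⇒a with alos v⇒a v⇒v′ a⇒b
      ...   | inj₁ v′~b = b , ~-sym v~b , ~-sym v′~b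
      ...   | inj₂ refl = a , ~-sym v~a , inj₁ a⇒b
      shift {v} {v′} {a} {b} v~a v~b a⇒b v⇒v′ | inj₂ a⇒v with alos a⇒v a⇒b v⇒v′
      ...   | inj₁ b~v′ = b , ~-sym v~b , b~v′
      ...   | inj₂ refl = a , ~-sym v~a , inj₁ a⇒b
    triangle-shift (a , b , v~a , v~b , inj₂ b⇒a) v⇒v′ = triangle-shift (b , a , v~b , v~a , inj₁ b⇒a) v⇒v′

    -- Shifting along the arc from `v` to `c (2 + i)` gives a common neighbour `y` of the two. Every
    -- orientation of its arcs leads to a vertex with two targets on the hole, or to a chord.
    core-noTriangle : ∀ {v} → Core v → ¬ InTriangle v
    core-noTriangle {v} (i , i⇒v) tri with successor i i⇒v
    ... | v⇒2+i with triangle-shift tri v⇒2+i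
    ...   | y , inj₂ v⇒y , y~2+i with successor (1 + i) (twin⁻ i i⇒v v⇒y) | y~2+i
    ...     | y⇒3+i | inj₂ 2+i⇒y = oneTarget (3 + i) 1 ℕ.≤-refl (≤L (s≤s (s≤s z≤n))) y⇒3+i (successor (2 + i) 2+i⇒y)
    ...     | y⇒3+i | inj₁ y⇒2+i = oneTarget (2 + i) 1 ℕ.≤-refl (≤L (s≤s (s≤s z≤n))) y⇒2+i y⇒3+i
    core-noTriangle {v} (i , i⇒v) tri | v⇒2+i | y , inj₁ y⇒v , inj₂ 2+i⇒y =
      oneTarget (2 + i) 3 (s≤s z≤n) (≤L (ℕ.n≤1+n 4)) v⇒2+i (successor (3 + i) (twin⁻ (2 + i) 2+i⇒y y⇒v))
    core-noTriangle {v} (i , i⇒v) tri | v⇒2+i | y , inj₁ y⇒v , inj₁ y⇒2+i with alos y⇒2+i y⇒v (c⇒c (2 + i))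
    ... | inj₂ refl          = chordless i 3 (s≤s (s≤s z≤n)) (≤L (ℕ.n≤1+n 4)) i⇒v
    ... | inj₁ (inj₁ v⇒3+i) = oneTarget (2 + i) 1 ℕ.≤-refl (≤L (s≤s (s≤s z≤n))) v⇒2+i v⇒3+i
    ... | inj₁ (inj₂ 3+i⇒v) =
      oneTarget (2 + i) 3 (s≤s z≤n) (≤L (ℕ.n≤1+n 4)) v⇒2+i (successor (3 + i) 3+i⇒v)

    noTriangle : ∀ {v} → ReachesCore v → ¬ InTriangle v
    noTriangle (t , core , v↝t) = go v↝t
      where
      go : ∀ {v} → Reach v t → ¬ InTriangle v
      go ε tri = core-noTriangle core tri
      go ((_ , _ , v⇒v′) ◅ rest) tri with triangle-shift tri v⇒v′
      ... | y , y~v , y~v′ = go rest (_ , y , inj₂ v⇒v′ , ~-sym y~v′ , ~-sym y~v)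

  -- Path covers

  record Piece (Q : Fin n → Set) (s : Fin n) : Set where
    field
      path     : Path D
      sound    : ∀ {v} → v ∈ₚ path → Q v
      complete : ∀ {v} → Q v → v ∈ₚ path
      extremal : Path.start path ≡ s ⊎ Path.end path ≡ s

  -- Encoded like `CliqueCover`: the paths span the fibres of `owner`, so they are disjoint and
  -- cover `W`.
  record PathCover (W S : Subset n) : Set where
    field
      owner   : Fin n → Fin n
      owner∈S : ∀ {v} → v ∈ W → owner v ∈ S
      owner-S : ∀ {s} → s ∈ S → owner s ≡ s
      piece   : ∀ {s} → s ∈ S → Piece (λ v → v ∈ W × owner v ≡ s) s

  path₁ : Fin n → Path D
  path₁ u = record { sequence = u ∷ [] ; linked = [-] ; distinct = [] ∷ [] }

  path₂ : ∀ u v → u ⇒ v → Path D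
  path₂ u v u⇒v = record
    { sequence = u ∷ v ∷ [] ; linked = u⇒v ∷ [-] ; distinct = (⇒⇒≢ u⇒v ∷ []) ∷ [] ∷ [] }

  path₃ : ∀ u v w → u ⇒ v → v ⇒ w → u ≢ w → Path D
  path₃ u v w u⇒v v⇒w u≢w = record
    { sequence = u ∷ v ∷ w ∷ [] ; linked = u⇒v ∷ v⇒w ∷ [-]
    ; distinct = (⇒⇒≢ u⇒v ∷ u≢w ∷ []) ∷ (⇒⇒≢ v⇒w ∷ []) ∷ [] ∷ [] }

  -- Covering the vertices attached to a hole

  module _ {W : Subset n} (H : Hole W) where

    open Hole H
    open HoleFacts H

    attached? : Decidable (λ v → v ∈ W × ReachesCore v)
    attached? v = (v ∈? W) ×-dec reachesCore? v

    V : Subset n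
    V = sift attached?

    V⊆W : V ⊆ W
    V⊆W = proj₁ ∘ ∈-sift⁻ attached?

    V-reaches : ∀ {v} → v ∈ V → ReachesCore v
    V-reaches = proj₂ ∘ ∈-sift⁻ attached?

    V-closed : ∀ {u v} → u ∈ V → v ∈ W → u ~ v → v ∈ V
    V-closed u∈V v∈W (inj₁ u⇒v) = ∈-sift⁺ attached? (v∈W , reachesCore-out (V-reaches u∈V) v∈W u⇒v)
    V-closed u∈V v∈W (inj₂ v⇒u) with V-reaches u∈V
    ... | t , core , u↝t = ∈-sift⁺ attached? (v∈W , t , core , (v∈W , V⊆W u∈V , v⇒u) ◅ u↝t)

    c∈V : c 0 ∈ V
    c∈V = ∈-sift⁺ attached? (c∈W 0 , c 0 , core-c 0 , ε)

    module _ (H′ : Hole V) where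

      private
        module H′ = Hole H′
        module F′ = HoleFacts H′

      alongside : ∀ m {a b} → c a ⇒ H′.c b → c (m + a) ⇒ H′.c (m + b)
      alongside zero        a⇒b = a⇒b
      alongside (suc m) {a} {b} a⇒b = twin⁻ (m + a) (alongside m a⇒b) (H′.c⇒c (m + b))

      -- Hence deleting any one class of `H` destroys all holes in `V`. The other hole reaches some
      -- `t` in the core of `H`, which also lies in its own core; by `twin⁻` both holes then advance
      -- in step.
      hole-meets : ∀ i → ∃[ j ] c i ⇒ H′.c j
      hole-meets i with V-reaches (H′.c∈W 0)
      ... | t , (i₀ , i₀⇒t) , 0↝t with go (F′.core-c 0) 0↝t
        where
        go : ∀ {u v} → F′.Core u → Reach u v → F′.Core v
        go core ε = core
        go core ((_ , _ , u⇒) ◅ rest) = go (F′.core-closed core u⇒) rest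
      -- From index 1 + i₀, advancing i + (1 + i₀)(L - 1) steps ends at i after 1 + i₀ full turns.
      ...   | j₀ , j₀⇒t = _ , subst (_⇒ H′.c _) (trans (cong c (eq i i₀ K)) (turns (suc i₀) i))
        (alongside (i + suc i₀ * (K + K)) (twin⁻ i₀ i₀⇒t (F′.successor j₀ j₀⇒t)))
        where
        eq : ∀ i i₀ K → i + suc i₀ * (K + K) + suc i₀ ≡ suc i₀ * suc (K + K) + i
        eq = solve-∀

    module _ {S : Subset n} (max : MaximumIn V S) where

      open MaximumIn max

      Meet : ℕ → Set
      Meet i = ∃[ s ] (s ∈ S × c i ⇒ s)

      meet? : Decidable Meet
      meet? i = any? λ s → (s ∈? S) ×-dec (c i ⇒? s)

      notConsecutive : ∀ i → Meet i → ¬ Meet (1 + i)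
      notConsecutive i (s , s∈S , i⇒s) (s′ , s′∈S , 1+i⇒s′) = indep s∈S s′∈S (inj₁ (twin⁺ i i⇒s 1+i⇒s′))

      Gap : ℕ → Set
      Gap i = ¬ Meet i × ¬ Meet (1 + i)

      module _ (noGap : ¬ (∃[ i ] (i < L × Gap i))) where

        hop : ∀ i → i < L → ¬ Meet i → Meet (1 + i)
        hop i i<L ¬m = decidable-stable (meet? (1 + i)) λ ¬m′ → noGap (i , i<L , ¬m , ¬m′)

        hops : ∀ e i → (e + e) + i ≤ L → Meet i → Meet ((e + e) + i)
        hops zero    i _  m = m
        hops (suc e) i ≤L m = subst (λ j → Meet (suc j + i)) (sym (ℕ.+-suc e e))
          (hop (suc (e + e + i)) lt (notConsecutive (e + e + i) (hops e i (ℕ.<⇒≤ (ℕ.<⇒≤ lt)) m)))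
          where
          lt : suc (e + e + i) < L
          lt = subst (λ j → suc j + i ≤ L) (ℕ.+-suc e e) ≤L

      -- Consecutive classes are completely joined, so they never both meet `S`. Without a gap,
      -- meeting and missing `S` would alternate around a cycle of odd length.
      gap : ∃[ i ] Gap i
      gap with anyUpTo? (λ i → ¬? (meet? i) ×-dec ¬? (meet? (1 + i))) L
      ... | yes (i , _ , gap) = i , gap
      ... | no noGap with meet? 0
      ...   | yes m@(s , s∈S , 0⇒s) = ⊥-elim (notConsecutive (K + K + 0)
        (hops noGap K 0 (ℕ.≤-trans (ℕ.≤-reflexive (ℕ.+-identityʳ _)) (ℕ.n≤1+n _)) m)
        (s , s∈S , subst (_⇒ s) (sym (period 0)) 0⇒s))
      ...   | no ¬m with hops noGap K 1 (ℕ.≤-reflexive (ℕ.+-comm (K + K) 1)) (hop noGap 0 (s≤s z≤n) ¬m)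
      ...     | s , s∈S , L⇒s = ⊥-elim (¬m
        (s , s∈S , subst (_⇒ s) (trans (cong c (ℕ.+-suc (K + K) 0)) (period 0)) L⇒s))

      module Avoiding (i : ℕ) (missed : ¬ Meet i) where

        U? : Decidable (λ v → v ∈ V × ¬ c i ⇒ v)
        U? v = (v ∈? V) ×-dec ¬? (c i ⇒? v)

        U : Subset n
        U = sift U?

        U-perfect : Perfect U
        U-perfect W′ W′⊆U with holeOrχ≡ω W′ (<-wellFounded _)
        ... | inj₂ P    = P
        ... | inj₁ hole = let j , i⇒j = hole-meets (hole-mono (proj₁ ∘ ∈-sift⁻ U? ∘ W′⊆U) hole) i in
                          contradiction i⇒j (proj₂ (∈-sift⁻ U? (W′⊆U (Hole.c∈W hole j))))

        max′ : MaximumIn U S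
        max′ = record
          { S⊆W     = λ s∈S → ∈-sift⁺ U? (S⊆W s∈S , λ i⇒s → missed (_ , s∈S , i⇒s))
          ; indep   = indep
          ; maximum = λ (A⊆U , A-indep) → maximum (proj₁ ∘ ∈-sift⁻ U? ∘ A⊆U , A-indep) }

        abstract
          cliques : CliqueCover U S
          cliques = cliqueCover U-perfect max′ (<-wellFounded _)

        open CliqueCover cliques public

        Free : Fin n → Set
        Free v = v ∈ V × ¬ c i ⇒ v × v ∉ S

        free? : Decidable Free
        free? v = (v ∈? V) ×-dec ¬? (c i ⇒? v) ×-dec ¬? (v ∈? S)

        free⇒U : ∀ {v} → Free v → v ∈ U
        free⇒U (v∈V , i⇏v , _) = ∈-sift⁺ U? (v∈V , i⇏v)

        owner~ : ∀ {v} → Free v → owner v ~ v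
        owner~ {v} free@(_ , _ , v∉S) = owner-clique (MaximumIn.S⊆W max′ o∈S) (free⇒U free) (owner-S o∈S)
          λ o≡v → v∉S (subst (_∈ S) o≡v o∈S)
          where o∈S = owner∈S (free⇒U free)

        -- Two vertices outside `S` with a common owner would form a triangle with it. So the clique
        -- cover is a matching of the free vertices into `S`.
        owner-injective : ∀ {u v} → Free u → Free v → owner u ≡ owner v → u ≡ v
        owner-injective {u} {v} fu fv eq = decidable-stable (u ≟ v) λ u≢v →
          noTriangle (V-reaches (proj₁ fu)) (owner u , v , ~-sym (owner~ fu) ,
            owner-clique (free⇒U fu) (free⇒U fv) eq u≢v , subst (_~ v) (sym eq) (owner~ fv))

      -- V minus either of two consecutive classes X, Z missed by S is matched
      -- into S.  Switching from the first matching to the second along the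
      -- alternating paths that start in X matches all of X; the paths that end
      -- in Z leave one vertex of Z each, to be appended after their origin.
      module Switching (i : ℕ) (missX : ¬ Meet i) (missZ : ¬ Meet (1 + i)) where

        module A₁ = Avoiding i missX
        module A₂ = Avoiding (1 + i) missZ
        X Z : Fin n → Set
        X v = c i ⇒ v
        Z v = c (1 + i) ⇒ v

        X⇒¬Z : ∀ {v} → X v → ¬ Z v
        X⇒¬Z x z = oneTarget (2 + i) 1 ℕ.≤-refl (≤L (s≤s (s≤s z≤n))) (successor i x) (successor (1 + i) z)

        X-free : ∀ {v} → v ∈ V → X v → A₂.Free v
        X-free v∈V x = v∈V , X⇒¬Z x , λ v∈S → missX (_ , v∈S , x)

        -- Once `u` takes its partner in the second matching, the vertex `v` holding that partner in
        -- the first must switch as well.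
        Switch : Fin n → Fin n → Set
        Switch u v = A₂.Free u × A₁.Free v × A₂.owner u ≡ A₁.owner v

        switch? : ∀ u v → Dec (Switch u v)
        switch? u v = A₂.free? u ×-dec A₁.free? v ×-dec (A₂.owner u ≟ A₁.owner v)

        From : Fin n → Fin n → Set
        From v x = (x ∈ V × X x) × Star Switch x v

        Switched : Fin n → Set
        Switched v = ∃[ x ] From v x

        switched? : Decidable Switched
        switched? v = any? λ x → ((x ∈? V) ×-dec (c i ⇒? x)) ×-dec star? switch? x v

        -- `Switch` is deterministic since the first matching is injective, and it stops at `Z`,
        -- where the second matching is undefined.
        target-unique : ∀ {x z z′} → Z z → Z z′ → Star Switch x z → Star Switch x z′ → z ≡ z′
        target-unique z z′ ε ε = refl
        target-unique z z′ ε ((free , _) ◅ _) = contradiction z (proj₁ (proj₂ free))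
        target-unique z z′ ((free , _) ◅ _) ε = contradiction z′ (proj₁ (proj₂ free))
        target-unique z z′ ((_ , fv , eq) ◅ p) ((_ , fv′ , eq′) ◅ p′)
          with A₁.owner-injective fv fv′ (trans (sym eq) eq′)
        ... | refl = target-unique z z′ p p′

        -- A switched vertex of `Z` has given up its first partner and has no second one; it is
        -- assigned to the new partner of the vertex of `X` where its alternating path began.
        ownerBy : ∀ v → Dec (v ∈ S) → Dec (Switched v) → Dec (Z v) → Fin n
        ownerBy v (yes _) _             _       = v
        ownerBy v (no _)  (yes (x , _)) (yes _) = A₂.owner x
        ownerBy v (no _)  (yes _)       (no _)  = A₂.owner v
        ownerBy v (no _)  (no _)        _       = A₁.owner v

        InnerBy : Fin n → Fin n → Set
        InnerBy v o = v ∈ V × v ∉ S × ((Switched v × A₂.Free v × o ≡ A₂.owner v)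
                                       ⊎ (¬ Switched v × A₁.Free v × o ≡ A₁.owner v))

        Tail : Fin n → Set
        Tail z = z ∈ V × Z z × Switched z

        abstract
          owner : Fin n → Fin n
          owner v = ownerBy v (v ∈? S) (switched? v) (c (1 + i) ⇒? v)

          owner-S : ∀ {s} → s ∈ S → owner s ≡ s
          owner-S {s} s∈S = go (s ∈? S) (switched? s) (c (1 + i) ⇒? s)
            where
            go : ∀ d₁ d₂ d₃ → ownerBy s d₁ d₂ d₃ ≡ s
            go (yes _)  _ _ = refl
            go (no s∉S) _ _ = contradiction s∈S s∉S

          owner-X : ∀ {x} → x ∈ V → X x → owner x ≡ A₂.owner x
          owner-X {x} x∈V xX = go (x ∈? S) (switched? x) (c (1 + i) ⇒? x)
            where
            go : ∀ d₁ d₂ d₃ → ownerBy x d₁ d₂ d₃ ≡ A₂.owner x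
            go (yes x∈S) _        _        = contradiction (x , x∈S , xX) missX
            go (no _)    (yes _)  (yes xZ) = contradiction xZ (X⇒¬Z xX)
            go (no _)    (yes _)  (no _)   = refl
            go (no _)    (no ¬sw) _        = contradiction (x , (x∈V , xX) , ε) ¬sw

          tail-owner : ∀ {z} → Tail z → ∃[ x ] (From z x × owner z ≡ A₂.owner x)
          tail-owner {z} (z∈V , zZ , sw) = go (z ∈? S) (switched? z) (c (1 + i) ⇒? z)
            where
            go : ∀ d₁ d₂ d₃ → ∃[ x ] (From z x × ownerBy z d₁ d₂ d₃ ≡ A₂.owner x)
            go (yes z∈S) _                _        = contradiction (z , z∈S , zZ) missZ
            go (no _)    (yes (x , from)) (yes _)  = x , from , refl
            go (no _)    (yes _)          (no ¬zZ) = contradiction zZ ¬zZ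
            go (no _)    (no ¬sw)         _        = contradiction sw ¬sw

          classify : ∀ {v} → v ∈ V → v ∈ S ⊎ Tail v ⊎ InnerBy v (owner v)
          classify {v} v∈V = go (v ∈? S) (switched? v) (c (1 + i) ⇒? v)
            where
            go : ∀ d₁ d₂ d₃ → v ∈ S ⊎ Tail v ⊎ InnerBy v (ownerBy v d₁ d₂ d₃)
            go (yes v∈S) _        _        = inj₁ v∈S
            go (no _)    (yes sw) (yes zZ) = inj₂ (inj₁ (v∈V , zZ , sw))
            go (no v∉S)  (yes sw) (no ¬zZ) = inj₂ (inj₂ (v∈V , v∉S , inj₁ (sw , (v∈V , ¬zZ , v∉S) , refl)))
            go (no v∉S)  (no ¬sw) _        = inj₂ (inj₂ (v∈V , v∉S , inj₂ (¬sw ,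
              (v∈V , (λ xX → ¬sw (v , (v∈V , xX) , ε)) , v∉S) , refl)))

        Inner : Fin n → Set
        Inner v = InnerBy v (owner v)

        tail? : Decidable Tail
        tail? z = (z ∈? V) ×-dec (c (1 + i) ⇒? z) ×-dec switched? z

        inner⇒¬tail : ∀ {v} → Inner v → ¬ Tail v
        inner⇒¬tail (_ , _ , inj₁ (_ , (_ , ¬zZ , _) , _)) (_ , zZ , _) = ¬zZ zZ
        inner⇒¬tail (_ , _ , inj₂ (¬sw , _))               (_ , _ , sw) = ¬sw sw

        ¬tail⇒inner : ∀ {v} → v ∈ V → v ∉ S → ¬ Tail v → Inner v
        ¬tail⇒inner v∈V v∉S ¬tail with classify v∈V
        ... | inj₁ v∈S           = contradiction v∈S v∉S
        ... | inj₂ (inj₁ tail)  = contradiction tail ¬tail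
        ... | inj₂ (inj₂ inner) = inner

        owner∈S : ∀ {v} → v ∈ V → owner v ∈ S
        owner∈S v∈V with classify v∈V
        ... | inj₁ v∈S = subst (_∈ S) (sym (owner-S v∈S)) v∈S
        ... | inj₂ (inj₁ tail) with tail-owner tail
        ...   | x , ((x∈V , xX) , _) , eq = subst (_∈ S) (sym eq) (A₂.owner∈S (A₂.free⇒U (X-free x∈V xX)))
        owner∈S v∈V | inj₂ (inj₂ (_ , _ , inj₁ (_ , free , eq))) = subst (_∈ S) (sym eq) (A₂.owner∈S (A₂.free⇒U free))
        owner∈S v∈V | inj₂ (inj₂ (_ , _ , inj₂ (_ , free , eq))) = subst (_∈ S) (sym eq) (A₁.owner∈S (A₁.free⇒U free))

        inner~ : ∀ {v} → Inner v → owner v ~ v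
        inner~ {v} (_ , _ , inj₁ (_ , free , eq)) = subst (_~ v) (sym eq) (A₂.owner~ free)
        inner~ {v} (_ , _ , inj₂ (_ , free , eq)) = subst (_~ v) (sym eq) (A₁.owner~ free)

        -- Within one matching this is injectivity. A switched and an unswitched vertex cannot share
        -- a partner, for `Switch` would extend to the latter.
        inner-unique : ∀ {u v} → Inner u → Inner v → owner u ≡ owner v → u ≡ v
        inner-unique (_ , _ , inj₁ (_ , fu , eu)) (_ , _ , inj₁ (_ , fv , ev)) eq =
          A₂.owner-injective fu fv (trans (sym eu) (trans eq ev))
        inner-unique (_ , _ , inj₂ (_ , fu , eu)) (_ , _ , inj₂ (_ , fv , ev)) eq =
          A₁.owner-injective fu fv (trans (sym eu) (trans eq ev))
        inner-unique (_ , _ , inj₁ ((x , xX , p) , fu , eu)) (_ , _ , inj₂ (¬sw , fv , ev)) eq =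
          contradiction (x , xX , p ◅◅ ((fu , fv , trans (sym eu) (trans eq ev)) ◅ ε)) ¬sw
        inner-unique (_ , _ , inj₂ (¬sw , fu , eu)) (_ , _ , inj₁ ((x , xX , p) , fv , ev)) eq =
          contradiction (x , xX , p ◅◅ ((fv , fu , trans (sym ev) (trans (sym eq) eu)) ◅ ε)) ¬sw

        tail-origin : ∀ {z} → Tail z → ∃[ x ] (Inner x × X x × Star Switch x z × owner x ≡ owner z)
        tail-origin tail with tail-owner tail
        ... | x , ((x∈V , xX) , p) , eq =
          x , (x∈V , proj₂ (proj₂ free) , inj₁ ((x , (x∈V , xX) , ε) , free , owner-X x∈V xX)) ,
          xX , p , trans (owner-X x∈V xX) (sym eq)
          where free = X-free x∈V xX

        tail-unique : ∀ {z z′} → Tail z → Tail z′ → owner z ≡ owner z′ → z ≡ z′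
        tail-unique tail@(_ , zZ , _) tail′@(_ , z′Z , _) eq with tail-origin tail | tail-origin tail′
        ... | x , inner , _ , p , e | x′ , inner′ , _ , p′ , e′
          with inner-unique inner inner′ (trans e (trans eq (sym e′)))
        ...   | refl = target-unique zZ z′Z p p′

        piece : ∀ {s} → s ∈ S → Piece (λ v → v ∈ V × owner v ≡ s) s
        piece {s} s∈S with any? (λ v → (v ∈? V) ×-dec ¬? (v ∈? S) ×-dec ¬? (tail? v) ×-dec (owner v ≟ s))
        ... | no none = record
          { path = path₁ s ; sound = λ { (here refl) → S⊆W s∈S , owner-S s∈S } ; complete = complete ; extremal = inj₁ refl }
          where
          complete : ∀ {v} → v ∈ V × owner v ≡ s → v ∈ₗ s ∷ []
          complete (v∈V , refl) with classify v∈V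
          ... | inj₁ v∈S = here (sym (owner-S v∈S))
          -- A tail brings along an inner vertex with the same owner, the origin of its alternating
          -- path.
          ... | inj₂ (inj₁ tail) with tail-origin tail
          ...   | x , inner@(x∈V , x∉S , _) , xX , _ , eq =
                  ⊥-elim (none (x , x∈V , x∉S , (λ (_ , xZ , _) → X⇒¬Z xX xZ) , eq))
          complete (v∈V , refl) | inj₂ (inj₂ inner) =
            ⊥-elim (none (_ , v∈V , proj₁ (proj₂ inner) , inner⇒¬tail inner , refl))
        ... | yes (v , v∈V , v∉S , ¬tail , refl) with any? (λ z → tail? z ×-dec (owner z ≟ owner v))
        ...   | yes (z , tail@(z∈V , zZ , _) , eq) = record
          { path = path₃ (owner v) v z s⇒v v⇒z λ { refl → missZ (_ , s∈S , zZ) }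
          ; sound = λ { (here refl) → S⊆W s∈S , owner-S s∈S ; (there (here refl)) → v∈V , refl
                      ; (there (there (here refl))) → z∈V , eq }
          ; complete = complete ; extremal = inj₁ refl }
          where
          inner : Inner v
          inner = ¬tail⇒inner v∈V v∉S ¬tail
          vX : X v
          vX with tail-origin tail
          ... | x , inner′ , xX , _ , eq′ = subst X (inner-unique inner′ inner (trans eq′ eq)) xX
          v⇒z : v ⇒ z
          v⇒z = twin⁺ i vX zZ
          s⇒v : owner v ⇒ v
          s⇒v with inner~ inner
          ... | inj₁ s⇒v = s⇒v
          -- All out-neighbours of a vertex of `X` lie in `Z`, which `S` misses; so the vertex of
          -- `S` is the start of the path.
          ... | inj₂ v⇒s = contradiction (_ , s∈S , twin⁻ i vX v⇒s) missZ
          complete : ∀ {u} → u ∈ V × owner u ≡ owner v → u ∈ₗ owner v ∷ v ∷ z ∷ []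
          complete (u∈V , e) with classify u∈V
          ... | inj₁ u∈S           = here (trans (sym (owner-S u∈S)) e)
          ... | inj₂ (inj₁ tail′)  = there (there (here (tail-unique tail′ tail (trans e (sym eq)))))
          ... | inj₂ (inj₂ inner′) = there (here (inner-unique inner′ inner e))
        ...   | no noTail = pair (inner~ inner)
          where
          inner : Inner v
          inner = ¬tail⇒inner v∈V v∉S ¬tail
          side : ∀ {u} → u ∈ V × owner u ≡ owner v → u ≡ owner v ⊎ u ≡ v
          side (u∈V , e) with classify u∈V
          ... | inj₁ u∈S           = inj₁ (trans (sym (owner-S u∈S)) e)
          ... | inj₂ (inj₁ tail′)  = ⊥-elim (noTail (_ , tail′ , e))
          ... | inj₂ (inj₂ inner′) = inj₂ (inner-unique inner′ inner e)
          pair : owner v ~ v → Piece (λ u → u ∈ V × owner u ≡ owner v) (owner v)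
          pair (inj₁ s⇒v) = record
            { path = path₂ (owner v) v s⇒v
            ; sound = λ { (here refl) → S⊆W s∈S , owner-S s∈S ; (there (here refl)) → v∈V , refl }
            ; complete = [ here , (λ e → there (here e)) ]′ ∘ side ; extremal = inj₁ refl }
          pair (inj₂ v⇒s) = record
            { path = path₂ v (owner v) v⇒s
            ; sound = λ { (there (here refl)) → S⊆W s∈S , owner-S s∈S ; (here refl) → v∈V , refl }
            ; complete = [ (λ e → there (here e)) , here ]′ ∘ side ; extremal = inj₂ refl }

        cover : PathCover V S
        cover = record { owner = owner ; owner∈S = owner∈S ; owner-S = owner-S ; piece = piece }

      holeCover : PathCover V S
      holeCover with gap
      ... | i , missX , missZ = Switching.cover i missX missZ

  -- Hamiltonian paths of cliques with a prescribed end

  Mutual : Fin n → Fin n → Set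
  Mutual u v = u ⇒ v × v ⇒ u

  Before After : Fin n → Fin n → Set
  Before v u = v ⇒ u × ¬ u ⇒ v
  After  v u = u ⇒ v × ¬ v ⇒ u

  -- Insertion as in Rédei's theorem: `v` goes before the first vertex of `t` to which it has an
  -- arc, or to the end.
  insertAfterHead : ∀ {v h} t → Linked _⇒_ (h ∷ t) → All (v ~_) t → h ⇒ v →
                    ∃[ t′ ] (Linked _⇒_ (h ∷ t′) × t′ ↭ v ∷ t)
  insertAfterHead {v} []      _              _          h⇒v = v ∷ [] , h⇒v ∷ [-] , ↭-refl
  insertAfterHead {v} (k ∷ t) (h⇒k ∷ linked) (v~k ∷ v~t) h⇒v with v ⇒? k | v~k
  ... | yes v⇒k | _        = v ∷ k ∷ t , h⇒v ∷ v⇒k ∷ linked , ↭-refl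
  ... | no v⇏k  | inj₁ v⇒k = contradiction v⇒k v⇏k
  ... | no _    | inj₂ k⇒v with insertAfterHead t linked v~t k⇒v
  ...   | t′ , linked′ , t′↭ = k ∷ t′ , h⇒k ∷ linked′ , ↭-trans (↭-prep k t′↭) (↭-swap k v ↭-refl)

  insertKeepingHead : ∀ {v h} t → Linked _⇒_ (h ∷ t) → All (v ~_) (h ∷ t) →
                      (∃[ t′ ] (Linked _⇒_ (h ∷ t′) × t′ ↭ v ∷ t)) ⊎ All (Before v) (h ∷ t)
  insertKeepingHead {v} {h} t linked (v~h ∷ v~t) with h ⇒? v | v~h
  ... | yes h⇒v | _        = inj₁ (insertAfterHead t linked v~t h⇒v)
  ... | no h⇏v  | inj₂ h⇒v = contradiction h⇒v h⇏v
  insertKeepingHead {v} {h} []      _              _           | no h⇏v | inj₁ v⇒h = inj₂ ((v⇒h , h⇏v) ∷ [])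
  insertKeepingHead {v} {h} (k ∷ t) (h⇒k ∷ linked) (_ ∷ v~kt) | no h⇏v | inj₁ v⇒h
    with insertKeepingHead t linked v~kt
  ... | inj₁ (t′ , linked′ , t′↭) = inj₁ (k ∷ t′ , h⇒k ∷ linked′ , ↭-trans (↭-prep k t′↭) (↭-swap k v ↭-refl))
  ... | inj₂ before               = inj₂ ((v⇒h , h⇏v) ∷ before)

  insertBetween : ∀ {v h s} t → Linked _⇒_ (h ∷ t ++ s ∷ []) → All (v ~_) (t ++ s ∷ []) → h ⇒ v →
                  (∃[ t′ ] (Linked _⇒_ (h ∷ t′ ++ s ∷ []) × t′ ↭ v ∷ t)) ⊎ All (After v) (t ++ s ∷ [])
  insertBetween {v} {s = s} [] _ (v~s ∷ []) h⇒v with v ⇒? s | v~s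
  ... | yes v⇒s | _        = inj₁ (v ∷ [] , h⇒v ∷ v⇒s ∷ [-] , ↭-refl)
  ... | no v⇏s  | inj₁ v⇒s = contradiction v⇒s v⇏s
  ... | no v⇏s  | inj₂ s⇒v = inj₂ ((s⇒v , v⇏s) ∷ [])
  insertBetween {v} (k ∷ t) (h⇒k ∷ linked) (v~k ∷ v~t) h⇒v with v ⇒? k | v~k
  ... | yes v⇒k | _        = inj₁ (v ∷ k ∷ t , h⇒v ∷ v⇒k ∷ linked , ↭-refl)
  ... | no v⇏k  | inj₁ v⇒k = contradiction v⇒k v⇏k
  ... | no v⇏k  | inj₂ k⇒v with insertBetween t linked v~t k⇒v
  ...   | inj₁ (t′ , linked′ , t′↭) = inj₁ (k ∷ t′ , h⇒k ∷ linked′ , ↭-trans (↭-prep k t′↭) (↭-swap k v ↭-refl))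
  ...   | inj₂ after                = inj₂ ((k⇒v , v⇏k) ∷ after)

  -- Counterpart of `insertKeepingHead` for a fixed last vertex, scanned from the left again: `v`
  -- goes before the first vertex to which it has an arc, and failure means that there is none.
  insertKeepingLast : ∀ {v s} t → Linked _⇒_ (t ++ s ∷ []) → All (v ~_) (t ++ s ∷ []) →
                      (∃[ t′ ] (Linked _⇒_ (t′ ++ s ∷ []) × t′ ↭ v ∷ t)) ⊎ All (After v) (t ++ s ∷ [])
  insertKeepingLast {v} {s} [] _ (v~s ∷ []) with v ⇒? s | v~s
  ... | yes v⇒s | _        = inj₁ (v ∷ [] , v⇒s ∷ [-] , ↭-refl)
  ... | no v⇏s  | inj₁ v⇒s = contradiction v⇒s v⇏s
  ... | no v⇏s  | inj₂ s⇒v = inj₂ ((s⇒v , v⇏s) ∷ [])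
  insertKeepingLast {v} (h ∷ t) linked (v~h ∷ v~t) with v ⇒? h | v~h
  ... | yes v⇒h | _        = inj₁ (v ∷ h ∷ t , v⇒h ∷ linked , ↭-refl)
  ... | no v⇏h  | inj₁ v⇒h = contradiction v⇒h v⇏h
  ... | no v⇏h  | inj₂ h⇒v with insertBetween t linked v~t h⇒v
  ...   | inj₁ (t′ , linked′ , t′↭) = inj₁ (h ∷ t′ , linked′ , ↭-trans (↭-prep h t′↭) (↭-swap h v ↭-refl))
  ...   | inj₂ after                = inj₂ ((h⇒v , v⇏h) ∷ after)

  mutualAfter : ∀ {v xs} → All (Before v) xs → AllPairs _~_ xs → AllPairs Mutual xs
  mutualAfter [] [] = []
  mutualAfter (v<x ∷ v<xs) (x~xs ∷ xs~) = All.zipWith (λ (v<y , x~y) → joined v<x v<y x~y) (v<xs , x~xs) ∷ mutualAfter v<xs xs~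
    where
    joined : ∀ {v x y} → Before v x → Before v y → x ~ y → Mutual x y
    joined (v⇒x , x⇏v) (v⇒y , y⇏v) (inj₁ x⇒y) with nontransitive v⇒x x⇒y v⇒y
    ... | inj₁ x⇒v        = contradiction x⇒v x⇏v
    ... | inj₂ (inj₁ y⇒x) = x⇒y , y⇒x
    ... | inj₂ (inj₂ y⇒v) = contradiction y⇒v y⇏v
    joined v<x v<y (inj₂ y⇒x) with joined v<y v<x (inj₁ y⇒x)
    ... | y⇒x , x⇒y = x⇒y , y⇒x

  mutualBefore : ∀ {v xs} → All (After v) xs → AllPairs _~_ xs → AllPairs Mutual xs
  mutualBefore [] [] = []
  mutualBefore (v>x ∷ v>xs) (x~xs ∷ xs~) = All.zipWith (λ (v>y , x~y) → joined v>x v>y x~y) (v>xs , x~xs) ∷ mutualBefore v>xs xs~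
    where
    joined : ∀ {v x y} → After v x → After v y → x ~ y → Mutual x y
    joined (x⇒v , v⇏x) (y⇒v , v⇏y) (inj₁ x⇒y) with nontransitive x⇒y y⇒v x⇒v
    ... | inj₁ y⇒x        = x⇒y , y⇒x
    ... | inj₂ (inj₁ v⇒y) = contradiction v⇒y v⇏y
    ... | inj₂ (inj₂ v⇒x) = contradiction v⇒x v⇏x
    joined v>x v>y (inj₂ y⇒x) with joined v>y v>x (inj₁ y⇒x)
    ... | y⇒x , x⇒y = x⇒y , y⇒x

  allPairs-↭ : ∀ {R : Fin n → Fin n → Set} {xs ys} → (∀ {u v} → R u v → R v u) → xs ↭ ys → AllPairs R xs → AllPairs R ys
  allPairs-↭ {R} R-sym xs↭ys = AllPairs-resp-↭ (setoid (Fin n)) R-sym (resp₂ R) (↭⇒↭ₛ xs↭ys)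

  mutual-sym : ∀ {u v} → Mutual u v → Mutual v u
  mutual-sym (u⇒v , v⇒u) = v⇒u , u⇒v

  data Extremal (s : Fin n) (xs : List (Fin n)) : Set where
    starts : ∀ t → Linked _⇒_ (s ∷ t) → s ∷ t ↭ s ∷ xs → Extremal s xs
    ends   : ∀ t → Linked _⇒_ (t ++ s ∷ []) → t ++ s ∷ [] ↭ s ∷ xs → Extremal s xs

  rotate : (s : Fin n) (t : List (Fin n)) → t ++ s ∷ [] ↭ s ∷ t
  rotate s t = ++-comm t (s ∷ [])

  -- Vertices are inserted one at a time.  A vertex that fits nowhere dominates,
  -- or is dominated by, all the others, which are then pairwise joined in both
  -- directions (no transitive triangles), so s can change ends.
  extremal : ∀ {s} xs → AllPairs _~_ (s ∷ xs) → Extremal s xs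
  extremal [] _ = starts [] [-] ↭-refl
  extremal {s} (v ∷ xs) ((s~v ∷ s~xs) ∷ (v~xs ∷ xs~)) with extremal xs (s~xs ∷ xs~)
  ... | starts t linked st↭ with insertKeepingHead t linked (All-resp-↭ (↭-sym st↭) (~-sym s~v ∷ v~xs))
  ...   | inj₁ (t′ , linked′ , t′↭) = starts t′ linked′
          (↭-trans (↭-prep s t′↭) (↭-trans (↭-swap s v ↭-refl) (↭-trans (↭-prep v st↭) (↭-swap v s ↭-refl))))
  ...   | inj₂ before = ends (v ∷ t) (AllPairs⇒Linked (All.map proj₁ (All-resp-↭ (↭-sym (rotate s t)) before)
            ∷ AllPairs.map proj₁ (allPairs-↭ mutual-sym (↭-sym (rotate s t))
                (mutualAfter before (allPairs-↭ ~-sym (↭-sym st↭) (s~xs ∷ xs~))))))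
          (↭-trans (↭-prep v (↭-trans (rotate s t) st↭)) (↭-swap v s ↭-refl))
  extremal {s} (v ∷ xs) ((s~v ∷ s~xs) ∷ (v~xs ∷ xs~))
      | ends t linked ts↭ with insertKeepingLast t linked (All-resp-↭ (↭-sym ts↭) (~-sym s~v ∷ v~xs))
  ...   | inj₁ (t′ , linked′ , t′↭) = ends t′ linked′
          (↭-trans (rotate s t′) (↭-trans (↭-prep s t′↭) (↭-trans (↭-swap s v ↭-refl)
            (↭-trans (↭-prep v (↭-trans (↭-sym (rotate s t)) ts↭)) (↭-swap v s ↭-refl)))))
  ...   | inj₂ after = starts (t ++ v ∷ []) (AllPairs⇒Linked (AllPairs.++⁺
            (AllPairs.map proj₁ (allPairs-↭ mutual-sym (rotate s t) (mutualBefore after (allPairs-↭ ~-sym (↭-sym ts↭) (s~xs ∷ xs~)))))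
            ([] ∷ [])
            (All.map (λ (u⇒v , _) → u⇒v ∷ []) (All-resp-↭ (rotate s t) after))))
          (↭-trans (↭-prep s (rotate v t)) (↭-trans (↭-swap s v ↭-refl)
            (↭-trans (↭-prep v (↭-trans (↭-sym (rotate s t)) ts↭)) (↭-swap v s ↭-refl))))

  unique : ∀ {xs ys} → xs ↭ ys → AllPairs _~_ ys → AllPairs _≢_ xs
  unique xs↭ys ys~ = AllPairs.map (λ { u~u refl → ~-irrefl u~u }) (allPairs-↭ ~-sym (↭-sym xs↭ys) ys~)

  cliquePiece : ∀ {Q s} xs → AllPairs _~_ (s ∷ xs) → (∀ {v} → v ∈ₗ s ∷ xs → Q v) → (∀ {v} → Q v → v ∈ₗ s ∷ xs) → Piece Q s
  cliquePiece {s = s} xs xs~ sound complete with extremal xs xs~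
  ... | starts t linked st↭ = record
    { path = record { sequence = s ∷ t ; linked = linked ; distinct = unique st↭ xs~ }
    ; sound = sound ∘ ∈-resp-↭ st↭ ; complete = ∈-resp-↭ (↭-sym st↭) ∘ complete ; extremal = inj₁ refl }
  ... | ends t linked ts↭ = record
    { path = record { sequence = t ∷ʳ s ; linked = subst (Linked _⇒_) (sym (toList-∷ʳ t s)) linked
                    ; distinct = unique ↭sxs xs~ }
    ; sound = sound ∘ ∈-resp-↭ ↭sxs ; complete = ∈-resp-↭ (↭-sym ↭sxs) ∘ complete ; extremal = inj₂ (last-∷ʳ t s) }
    where
    ↭sxs : toList (t ∷ʳ s) ↭ s ∷ xs
    ↭sxs = subst (_↭ s ∷ xs) (sym (toList-∷ʳ t s)) ts↭

  cliquePathCover : ∀ {W S} → MaximumIn W S → CliqueCover W S → PathCover W S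
  cliquePathCover {W} {S} max cover = record { owner = owner ; owner∈S = owner∈S ; owner-S = owner-S ; piece = piece }
    where
    open MaximumIn max
    open CliqueCover cover
    piece : ∀ {s} → s ∈ S → Piece (λ v → v ∈ W × owner v ≡ s) s
    piece {s} s∈S = cliquePiece others pairs sound complete
      where
      other? : Decidable (λ v → (v ∈ W × owner v ≡ s) × v ≢ s)
      other? v = ((v ∈? W) ×-dec (owner v ≟ s)) ×-dec ¬? (v ≟ s)
      others : List (Fin n)
      others = filter other? (allFin n)
      s! : s ∈ W × owner s ≡ s
      s! = S⊆W s∈S , owner-S s∈S
      sound : ∀ {v} → v ∈ₗ s ∷ others → v ∈ W × owner v ≡ s
      sound (here refl) = s!
      sound (there v∈)  = proj₁ (proj₂ (∈-filter⁻ other? {xs = allFin n} v∈))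
      complete : ∀ {v} → v ∈ W × owner v ≡ s → v ∈ₗ s ∷ others
      complete {v} v! with v ≟ s
      ... | yes v≡s = here v≡s
      ... | no  v≢s = there (∈-filter⁺ other? (∈-allFin v) (v! , v≢s))
      distinct : AllPairs _≢_ (s ∷ others)
      distinct = All.tabulate (λ v∈ s≡v → proj₂ (proj₂ (∈-filter⁻ other? {xs = allFin n} v∈)) (sym s≡v))
               ∷ filter⁺ other? (allFin⁺ n)
      adjacent : ∀ xs → (∀ {v} → v ∈ₗ xs → v ∈ W × owner v ≡ s) → AllPairs _≢_ xs → AllPairs _~_ xs
      adjacent []       _     _           = []
      adjacent (x ∷ xs) class (x≢ ∷ xs≢) =
        All.tabulate (λ v∈ → let x∈W , ox = class (here refl) ; v∈W , ov = class (there v∈) in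
          owner-clique x∈W v∈W (trans ox (sym ov)) (All.lookup x≢ v∈))
        ∷ adjacent xs (class ∘ there) xs≢
      pairs : AllPairs _~_ (s ∷ others)
      pairs = adjacent (s ∷ others) sound distinct

  -- Assembly over unions of weak components

  -- No edge joins `C` to the rest of `W`, so any independent set in `C` may replace `S ∩ C` within
  -- `S`.
  maximum-∩ : ∀ {W S C} → MaximumIn W S → C ⊆ W → (∀ {u v} → u ∈ C → v ∈ W → u ~ v → v ∈ C) →
              MaximumIn C (S ∩ C)
  maximum-∩ {W} {S} {C} max C⊆W closed = record
    { S⊆W     = p∩q⊆q S C
    ; indep   = λ u∈ v∈ → indep (p∩q⊆p S C u∈) (p∩q⊆p S C v∈)
    ; maximum = λ {A} (A⊆C , A-indep) → ℕ.+-cancelʳ-≤ (∣ S ─ C ∣) (∣ A ∣) (∣ S ∩ C ∣) (begin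
        ∣ A ∣ + ∣ S ─ C ∣         ≤⟨ ∣p∣+∣q∣≤∣p∪q∣ A (S ─ C) (λ v∈A v∈S─C → x∈p─q⇒x∉q {p = S} v∈S─C (A⊆C v∈A)) ⟩
        ∣ A ∪ (S ─ C) ∣           ≤⟨ maximum (A∪⊆W A⊆C , A∪-indep A⊆C A-indep) ⟩
        ∣ S ∣                     ≤⟨ ∣p∣≤∣p─q∣+∣p∩q∣ S C ⟩
        ∣ S ─ C ∣ + ∣ S ∩ C ∣     ≡⟨ ℕ.+-comm ∣ S ─ C ∣ _ ⟩
        ∣ S ∩ C ∣ + ∣ S ─ C ∣     ∎) }
    where
    open ℕ.≤-Reasoning
    open MaximumIn max
    A∪⊆W : ∀ {A} → A ⊆ C → A ∪ (S ─ C) ⊆ W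
    A∪⊆W {A} A⊆C v∈ with x∈p∪q⁻ A (S ─ C) v∈
    ... | inj₁ v∈A  = C⊆W (A⊆C v∈A)
    ... | inj₂ v∈S′ = S⊆W (p─q⊆p S C v∈S′)
    apart : ∀ {u v} → u ∈ C → v ∈ S ─ C → ¬ u ~ v
    apart u∈C v∈S′ u~v = x∈p─q⇒x∉q {p = S} v∈S′ (closed u∈C (S⊆W (p─q⊆p S C v∈S′)) u~v)
    A∪-indep : ∀ {A} → A ⊆ C → Independent A → Independent (A ∪ (S ─ C))
    A∪-indep {A} A⊆C A-indep u∈ v∈ u~v with x∈p∪q⁻ A (S ─ C) u∈ | x∈p∪q⁻ A (S ─ C) v∈
    ... | inj₁ u∈A  | inj₁ v∈A  = A-indep u∈A v∈A u~v
    ... | inj₁ u∈A  | inj₂ v∈S′ = apart (A⊆C u∈A) v∈S′ u~v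
    ... | inj₂ u∈S′ | inj₁ v∈A  = apart (A⊆C v∈A) u∈S′ (~-sym u~v)
    ... | inj₂ u∈S′ | inj₂ v∈S′ = indep (p─q⊆p S C u∈S′) (p─q⊆p S C v∈S′) u~v

  module Join {W S C} (S⊆W : S ⊆ W) (C⊆W : C ⊆ W)
              (P : PathCover C (S ∩ C)) (Q : PathCover (W ─ C) (S ∩ (W ─ C))) where

    private
      module P = PathCover P
      module Q = PathCover Q

    ownerBy : ∀ v → Dec (v ∈ C) → Fin n
    ownerBy v (yes _) = P.owner v
    ownerBy v (no _)  = Q.owner v

    owner : Fin n → Fin n
    owner v = ownerBy v (v ∈? C)

    owner-C : ∀ {v} → v ∈ C → owner v ≡ P.owner v
    owner-C {v} v∈C = go (v ∈? C)
      where
      go : ∀ d → ownerBy v d ≡ P.owner v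
      go (yes _)  = refl
      go (no v∉C) = contradiction v∈C v∉C

    owner-∁ : ∀ {v} → v ∉ C → owner v ≡ Q.owner v
    owner-∁ {v} v∉C = go (v ∈? C)
      where
      go : ∀ d → ownerBy v d ≡ Q.owner v
      go (yes v∈C) = contradiction v∈C v∉C
      go (no _)    = refl

    ownerC∈ : ∀ {v} → v ∈ C → owner v ∈ S ∩ C
    ownerC∈ v∈C = subst (_∈ S ∩ C) (sym (owner-C v∈C)) (P.owner∈S v∈C)

    owner∁∈ : ∀ {v} → v ∈ W → v ∉ C → owner v ∈ S ∩ (W ─ C)
    owner∁∈ v∈W v∉C = subst (_∈ S ∩ (W ─ C)) (sym (owner-∁ v∉C)) (Q.owner∈S (x∈p∧x∉q⇒x∈p─q v∈W v∉C))

    rewrap : ∀ {A B : Fin n → Set} {s} → (∀ {v} → A v → B v) → (∀ {v} → B v → A v) → Piece A s → Piece B s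
    rewrap f g piece = record { path = path ; sound = f ∘ sound ; complete = complete ∘ g ; extremal = ext }
      where open Piece piece renaming (extremal to ext)

    join : PathCover W S
    join = record { owner = owner ; owner∈S = owner∈S ; owner-S = owner-S ; piece = piece }
      where
      owner∈S : ∀ {v} → v ∈ W → owner v ∈ S
      owner∈S {v} v∈W with v ∈? C
      ... | yes v∈C = p∩q⊆p S C (P.owner∈S v∈C)
      ... | no  v∉C = p∩q⊆p S (W ─ C) (Q.owner∈S (x∈p∧x∉q⇒x∈p─q v∈W v∉C))
      owner-S : ∀ {s} → s ∈ S → owner s ≡ s
      owner-S {s} s∈S with s ∈? C
      ... | yes s∈C = P.owner-S (x∈p∩q⁺ (s∈S , s∈C))
      ... | no  s∉C = Q.owner-S (x∈p∩q⁺ (s∈S , x∈p∧x∉q⇒x∈p─q (S⊆W s∈S) s∉C))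
      piece : ∀ {s} → s ∈ S → Piece (λ v → v ∈ W × owner v ≡ s) s
      piece {s} s∈S = go (s ∈? C)
        where
        go : Dec (s ∈ C) → Piece (λ v → v ∈ W × owner v ≡ s) s
        go (yes s∈C) = rewrap (λ (v∈C , eq) → C⊆W v∈C , trans (owner-C v∈C) eq) back (P.piece (x∈p∩q⁺ (s∈S , s∈C)))
          where
          back : ∀ {v} → v ∈ W × owner v ≡ s → v ∈ C × P.owner v ≡ s
          back {v} (v∈W , eq) = v∈C , trans (sym (owner-C v∈C)) eq
            where
            v∈C : v ∈ C
            v∈C = decidable-stable (v ∈? C) λ v∉C →
              x∈p─q⇒x∉q {p = W} (subst (_∈ W ─ C) eq (p∩q⊆q S (W ─ C) (owner∁∈ v∈W v∉C))) s∈C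
        go (no s∉C) = rewrap (λ (v∈ , eq) → p─q⊆p W C v∈ , trans (owner-∁ (x∈p─q⇒x∉q {p = W} v∈)) eq) back
                        (Q.piece (x∈p∩q⁺ (s∈S , x∈p∧x∉q⇒x∈p─q (S⊆W s∈S) s∉C)))
          where
          back : ∀ {v} → v ∈ W × owner v ≡ s → v ∈ W ─ C × Q.owner v ≡ s
          back {v} (v∈W , eq) = x∈p∧x∉q⇒x∈p─q v∈W v∉C , trans (sym (owner-∁ v∉C)) eq
            where
            v∉C : v ∉ C
            v∉C v∈C = s∉C (subst (_∈ C) eq (p∩q⊆q S C (ownerC∈ v∈C)))

  holeOrPerfect : ∀ W → Hole W ⊎ Perfect W
  holeOrPerfect W = allSubsets-⊎ decide
    where
    decide : ∀ A → Hole W ⊎ (A ⊆ W → χ≡ω A)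
    decide A with A ⊆? W
    ... | no  A⊈W = inj₂ λ A⊆W → ⊥-elim (A⊈W A⊆W)
    ... | yes A⊆W with holeOrχ≡ω A (<-wellFounded _)
    ...   | inj₁ hole = inj₁ (hole-mono A⊆W hole)
    ...   | inj₂ P    = inj₂ λ _ → P

  -- No edge joins `V H` to the rest of `W`, so the two are covered independently; the rest may
  -- contain further holes, hence the induction.
  pathCover : ∀ W S → MaximumIn W S → Acc _<_ ∣ W ∣ → PathCover W S
  pathCover W S max (acc rec) with holeOrPerfect W
  ... | inj₂ perfect = cliquePathCover max (cliqueCover perfect max (<-wellFounded _))
  ... | inj₁ H = Join.join (MaximumIn.S⊆W max) (V⊆W H)
    (holeCover H (maximum-∩ max (V⊆W H) (V-closed H)))
    (pathCover (W ─ V H) (S ∩ (W ─ V H)) (maximum-∩ max (p─q⊆p W (V H)) closed)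
      (rec (p∩q≢∅⇒∣p─q∣<∣p∣ W (V H) (_ , x∈p∩q⁺ (V⊆W H (c∈V H) , c∈V H)))))
    where
    closed : ∀ {u v} → u ∈ W ─ V H → v ∈ W → u ~ v → v ∈ W ─ V H
    closed u∈ v∈W u~v = x∈p∧x∉q⇒x∈p─q v∈W λ v∈V →
      x∈p─q⇒x∉q {p = W} u∈ (V-closed H v∈V (p─q⊆p W (V H) u∈) (~-sym u~v))

  beProperty : BEProperty D
  beProperty S (stable , maximum) = record
    { partition = record { size = length sources ; path = path ; covers = covers }
    ; meetsOnce = meetsOnce
    ; extremal  = extremal-S }
    where
    sources : List (Fin n)
    sources = filter (_∈? S) (allFin n)
    max : MaximumIn ⊤ S
    max = record { S⊆W = ⊆⊤ ; indep = stable ; maximum = λ (_ , A-stable) → maximum _ A-stable }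
    open PathCover (pathCover ⊤ S max (<-wellFounded _))
    source∈S : ∀ i → lookupₗ sources i ∈ S
    source∈S i = proj₂ (∈-filter⁻ (_∈? S) {xs = allFin n} (∈-lookup i))
    pieceAt : ∀ i → Piece (λ v → v ∈ ⊤ × owner v ≡ lookupₗ sources i) (lookupₗ sources i)
    pieceAt i = piece (source∈S i)
    path : Fin (length sources) → Path D
    path i = Piece.path (pieceAt i)
    index : ∀ {s} → s ∈ S → ∃[ i ] lookupₗ sources i ≡ s
    index {s} s∈S = let s∈ = ∈-filter⁺ (_∈? S) (∈-allFin s) s∈S in Any.index s∈ , sym (lookup-index s∈)
    extremal-S : ∀ {s} → s ∈ S → ∃[ i ] (Path.start (path i) ≡ s ⊎ Path.end (path i) ≡ s)
    extremal-S s∈S with index s∈S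
    ... | i , refl = i , Piece.extremal (pieceAt i)
    covers : ∀ v → ∃! _≡_ (λ i → v ∈ₚ path i)
    covers v with index (owner∈S (∈⊤ {x = v}))
    ... | i , eq = i , Piece.complete (pieceAt i) (∈⊤ , sym eq) , λ {j} v∈j →
      lookup-injective (filter⁺ (_∈? S) (allFin⁺ n)) (trans eq (proj₂ (Piece.sound (pieceAt j) v∈j)))
    meetsOnce : ∀ i → ∃! _≡_ (λ v → v ∈ₚ path i × v ∈ S)
    meetsOnce i = lookupₗ sources i , (Piece.complete (pieceAt i) (∈⊤ , owner-S (source∈S i)) , source∈S i) ,
      λ (v∈i , v∈S) → trans (sym (proj₂ (Piece.sound (pieceAt i) v∈i))) (owner-S v∈S)

-- From blocking odd cycles to the theorem

-- With no arc reversed, the triangle is a blocking odd cycle with k = 1, listed as a, c, b so that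
-- the source a is followed by the sink c.
noTransitiveTriangle : (D : Digraph n) → ¬ ContainsInducedBlockingOddCycle D →
  ∀ {a b c} → Edge D a b → Edge D b c → Edge D a c → Edge D b a ⊎ Edge D c b ⊎ Edge D c a
noTransitiveTriangle {n} D free {a} {b} {c} a⇒b b⇒c a⇒c with b ⇒? a | c ⇒? b | c ⇒? a
  where open DigraphGraph D
... | yes b⇒a | _       | _       = inj₁ b⇒a
... | no _    | yes c⇒b | _       = inj₂ (inj₁ c⇒b)
... | no _    | no _    | yes c⇒a = inj₂ (inj₂ c⇒a)
... | no b⇏a  | no c⇏b  | no c⇏a  = ⊥-elim (free (3 , C , record { f = f ; injective = injective ; induced = λ _ _ → refl } , record
  { j = 0 ; vertices = ⤖-id (Fin 3) ; cycle = cycle ; source = source ; sink = sink }))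
  where
  open DigraphGraph D using (⇒⇒≢)
  f : Fin 3 → Fin n
  f zero             = a
  f (suc zero)       = c
  f (suc (suc zero)) = b
  C : Digraph 3
  C = record { edge = λ u v → edge D (f u) (f v) ; loopless = loopless D ∘ f }
  injective : ∀ {u v} → f u ≡ f v → u ≡ v
  injective {zero}           {zero}           _  = refl
  injective {zero}           {suc zero}       eq = contradiction eq (⇒⇒≢ a⇒c)
  injective {zero}           {suc (suc zero)} eq = contradiction eq (⇒⇒≢ a⇒b)
  injective {suc zero}       {zero}           eq = contradiction (sym eq) (⇒⇒≢ a⇒c)
  injective {suc zero}       {suc zero}       _  = refl
  injective {suc zero}       {suc (suc zero)} eq = contradiction (sym eq) (⇒⇒≢ b⇒c)
  injective {suc (suc zero)} {zero}           eq = contradiction (sym eq) (⇒⇒≢ a⇒b)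
  injective {suc (suc zero)} {suc zero}       eq = contradiction eq (⇒⇒≢ b⇒c)
  injective {suc (suc zero)} {suc (suc zero)} _  = refl
  cycle : ∀ u v → Adjacent C u v ⇔ (Next u v ⊎ Next v u)
  cycle zero             zero             = mk⇔ (⊥-elim ∘ [ loopless D a , loopless D a ]′) λ { (inj₁ ()) ; (inj₂ ()) }
  cycle zero             (suc zero)       = mk⇔ (λ _ → inj₁ refl) (λ _ → inj₁ a⇒c)
  cycle zero             (suc (suc zero)) = mk⇔ (λ _ → inj₂ refl) (λ _ → inj₁ a⇒b)
  cycle (suc zero)       zero             = mk⇔ (λ _ → inj₂ refl) (λ _ → inj₂ a⇒c)
  cycle (suc zero)       (suc zero)       = mk⇔ (⊥-elim ∘ [ loopless D c , loopless D c ]′) λ { (inj₁ ()) ; (inj₂ ()) }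
  cycle (suc zero)       (suc (suc zero)) = mk⇔ (λ _ → inj₁ refl) (λ _ → inj₂ b⇒c)
  cycle (suc (suc zero)) zero             = mk⇔ (λ _ → inj₁ refl) (λ _ → inj₂ a⇒b)
  cycle (suc (suc zero)) (suc zero)       = mk⇔ (λ _ → inj₂ refl) (λ _ → inj₁ b⇒c)
  cycle (suc (suc zero)) (suc (suc zero)) = mk⇔ (⊥-elim ∘ [ loopless D b , loopless D b ]′) λ { (inj₁ ()) ; (inj₂ ()) }
  source : IsSource C zero
  source zero             = loopless D a
  source (suc zero)       = c⇏a
  source (suc (suc zero)) = b⇏a
  sink : IsSink C (suc zero)
  sink zero             = c⇏a
  sink (suc zero)       = loopless D c
  sink (suc (suc zero)) = c⇏b

theorem30 : (n : ℕ) (D : Digraph n) → ArcLocallyOutSemicomplete D →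
    ¬ ContainsInducedBlockingOddCycle D → BEDiperfect D
theorem30 n D alos free H H⊆D = LocallyOutSemicomplete.beProperty H alos-H nontransitive-H
  where
  open _IsInducedSubdigraphOf_ H⊆D
  up : ∀ {u v} → Edge H u v → Edge D (f u) (f v)
  up {u} {v} = subst T (induced u v)
  down : ∀ {u v} → Edge D (f u) (f v) → Edge H u v
  down {u} {v} = subst T (sym (induced u v))
  alos-H : ArcLocallyOutSemicomplete H
  alos-H u⇒v u⇒x v⇒y with alos (up u⇒v) (up u⇒x) (up v⇒y)
  ... | inj₁ (inj₁ x⇒y) = inj₁ (inj₁ (down x⇒y))
  ... | inj₁ (inj₂ y⇒x) = inj₁ (inj₂ (down y⇒x))
  ... | inj₂ fx≡fy       = inj₂ (injective fx≡fy)
  nontransitive-H : ∀ {a b c} → Edge H a b → Edge H b c → Edge H a c → Edge H b a ⊎ Edge H c b ⊎ Edge H c a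
  nontransitive-H a⇒b b⇒c a⇒c with noTransitiveTriangle D free (up a⇒b) (up b⇒c) (up a⇒c)
  ... | inj₁ b⇒a        = inj₁ (down b⇒a)
  ... | inj₂ (inj₁ c⇒b) = inj₂ (inj₁ (down c⇒b))
  ... | inj₂ (inj₂ c⇒a) = inj₂ (inj₂ (down c⇒a))
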